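{- For every algebra $\mathbf{A}$ (of an arbitrary purely algebraic signature), the following are equivalent. 1. $\mathbf{A}$ satisfies a nontrivial idempotent equational condition. 2. $\mathbf{A}$ has a $6$-ary idempotent term $t$ such that $\mathbf{A}$ satisfies the equations \[ t(x,y,y,y,x,x) \approx t(y,x,y,x,y,x) \approx t(y,y,x,x,x,y). \]
   Context: A signature is a set of operation symbols with associated finite arities. An algebra $\mathbf{A}$ of signature $\Sigma$ is a set $A$ together with an operation $f^{\mathbf{A}}:A^{\mathrm{Ar} f}\to A$ for each $f\in\Sigma$, where $\mathrm{Ar} f$ is the arity of $f$. A term of $\mathbf{A}$ is a term in the signature $\Sigma$. An equation is a pair of terms, written $s\approx t$; $\mathbf{A}$ satisfies $s\approx t$ if both terms evaluate to the same element under every evaluation of the variables in $A$. A term $t$ is idempotent (in $\mathbf A$) if $\mathbf{A}$ satisfies $t(x,x,\dots,x)\approx x$. An equational condition $\mathcal{S}$ is a system of equations in some signature $\Delta$. An algebra $\mathbf{A}$ of a signature $\Sigma$ satisfies the equational condition $\mathcal{S}$ if one can replace each operation symbol in $\Delta$ by a term in the signature $\Sigma$ (of the same arity) so that all equations of $\mathcal{S}$ become satisfied in $\mathbf{A}$. An equational condition is trivial if it is satisfied in every algebra (equivalently, in an algebra in the empty signature with at least two elements, where all terms are variables), and nontrivial otherwise. An equational condition is idempotent if for each operation symbol $f$ appearing in it, the equation $f(x,x,\dots,x)\approx x$ is a consequence of its equations (i.e., it holds in every algebra of signature $\Delta$ satisfying all the equations of the condition). -}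

module Defs where

open import Axiom.ExcludedMiddle using (ExcludedMiddle)
open import Axiom.Extensionality.Propositional using (Extensionality)
open import Data.Fin using (Fin)
open import Data.Nat using (ℕ)
open import Data.Product using (_×_; _,_; Σ-syntax)
open import Data.Vec.Functional using (Vector; []; _∷_; replicate)
open import Data.Vec.Functional.Relation.Binary.Pointwise using (Pointwise)
open import Level using (Level; suc; Setω)
open import Relation.Binary.Bundles using (Setoid)
open import Relation.Nullary using (¬_)

-- The ambient classical set theory.  `ExcludedMiddle` decides every type, not
-- only the propositions, so it yields a map ¬ ¬ P → P for every type P and with
-- it the axiom of choice for families of types.  Function extensionality makes
-- that choice well defined on subsets, represented as functions X → Bool.
record Classical : Setω where
  field
    excludedMiddle : ∀ {a} → ExcludedMiddle a
    extensionality : ∀ {a b} → Extensionality a b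

-- A universe level ℓ plays the role of the universe of sets: signatures,
-- carriers and systems of equations all live in Set ℓ.
record Signature (ℓ : Level) : Set (suc ℓ) where
  field
    Op    : Set ℓ
    arity : Op → ℕ

open Signature public

-- Carriers are setoids, so that quotient algebras such as free algebras exist.
record Algebra {ℓ} (S : Signature ℓ) : Set (suc ℓ) where
  field
    setoid : Setoid ℓ ℓ
  open Setoid setoid public using (Carrier; _≈_)
  field
    op      : (f : Op S) → Vector Carrier (arity S f) → Carrier
    op-cong : (f : Op S) {xs ys : Vector Carrier (arity S f)} →
              Pointwise _≈_ xs ys → op f xs ≈ op f ys

data Term {ℓ} (S : Signature ℓ) (X : Set) : Set ℓ where
  var : X → Term S X
  app : (f : Op S) → Vector (Term S X) (arity S f) → Term S X

-- The variables of an n-ary term are its n argument places.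
TermOfArity : ∀ {ℓ} → Signature ℓ → ℕ → Set ℓ
TermOfArity S n = Term S (Fin n)

infix 30 _[_]
_[_] : ∀ {ℓ} {S : Signature ℓ} {X Y : Set} →
       Term S X → (X → Term S Y) → Term S Y
var x    [ σ ] = σ x
app f ts [ σ ] = app f (λ i → ts i [ σ ])

eval : ∀ {ℓ} {S : Signature ℓ} (A : Algebra S) {X : Set} →
       (X → Algebra.Carrier A) → Term S X → Algebra.Carrier A
eval A ρ (var x)    = ρ x
eval A ρ (app f ts) = Algebra.op A f (λ i → eval A ρ (ts i))

infix 5 _≋_
record Equation {ℓ} (S : Signature ℓ) : Set ℓ where
  constructor _≋_
  field
    lhs rhs : Term S ℕ

infix 4 _⊨_
_⊨_ : ∀ {ℓ} {S : Signature ℓ} → Algebra S → Equation S → Set ℓ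
A ⊨ s ≋ t = ∀ ρ → eval A ρ s ≈ eval A ρ t
  where open Algebra A

module _ {ℓ} {S : Signature ℓ} where

  x y : Term S ℕ
  x = var 0
  y = var 1

  IsIdempotentIn : ∀ {n} → Algebra S → TermOfArity S n → Set ℓ
  IsIdempotentIn {n} A t = A ⊨ t [ replicate n x ] ≋ x

-- A possibly infinite family of equations in a possibly infinite signature.
record EquationalCondition (ℓ : Level) : Set (suc ℓ) where
  field
    signature : Signature ℓ
    Index     : Set ℓ
    equation  : Index → Equation signature

Interpretation : ∀ {ℓ} → Signature ℓ → Signature ℓ → Set ℓ
Interpretation Δ S = (f : Op Δ) → TermOfArity S (arity Δ f)

translate : ∀ {ℓ} {Δ S : Signature ℓ} {X : Set} →
            Interpretation Δ S → Term Δ X → Term S X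
translate τ (var x)    = var x
translate τ (app f ts) = τ f [ (λ i → translate τ (ts i)) ]

translateEquation : ∀ {ℓ} {Δ S : Signature ℓ} →
                    Interpretation Δ S → Equation Δ → Equation S
translateEquation τ (s ≋ t) = translate τ s ≋ translate τ t

module _ {ℓ} (𝒮 : EquationalCondition ℓ) where
  open EquationalCondition 𝒮

  SatisfiedIn : {S : Signature ℓ} → Algebra S → Set ℓ
  SatisfiedIn {S} A =
    Σ[ τ ∈ Interpretation signature S ]
      (∀ i → A ⊨ translateEquation τ (equation i))

  Trivial : Set (suc ℓ)
  Trivial = {S : Signature ℓ} (A : Algebra S) → SatisfiedIn A

  Nontrivial : Set (suc ℓ)
  Nontrivial = ¬ Trivial

  -- The operation symbols of the condition are all those of its signature.
  -- An unused symbol of positive arity could be omitted or read as a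
  -- projection, but an unused nullary symbol c with no equations would be
  -- nontrivial and, if exempt from idempotence, satisfied in any pointed set.
  IdempotentCondition : Set (suc ℓ)
  IdempotentCondition =
    (f : Op signature) (B : Algebra signature) →
    (∀ i → B ⊨ equation i) →
    B ⊨ app f (replicate (arity signature f) x) ≋ x

SatisfiesNontrivialIdempotentCondition :
  ∀ {ℓ} {S : Signature ℓ} → Algebra S → Set (suc ℓ)
SatisfiesNontrivialIdempotentCondition {ℓ} A =
  Σ[ 𝒮 ∈ EquationalCondition ℓ ]
    Nontrivial 𝒮 × IdempotentCondition 𝒮 × SatisfiedIn 𝒮 A

-- Two consecutive equations express t₁ ≈ t₂ ≈ t₃.
HasOlšákTerm : ∀ {ℓ} {S : Signature ℓ} → Algebra S → Set ℓ
HasOlšákTerm {S = S} A =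
  Σ[ t ∈ TermOfArity S 6 ]
    IsIdempotentIn A t
    × A ⊨ t [ x ∷ y ∷ y ∷ y ∷ x ∷ x ∷ [] ] ≋ t [ y ∷ x ∷ y ∷ x ∷ y ∷ x ∷ [] ]
    × A ⊨ t [ y ∷ x ∷ y ∷ x ∷ y ∷ x ∷ [] ] ≋ t [ y ∷ y ∷ x ∷ x ∷ x ∷ y ∷ [] ]

{-# OPTIONS --safe #-}
-- Interpreted in A, the symbols of a nontrivial idempotent condition form an idempotent algebra B.
-- An assignment of a projection to every symbol at every depth of a term that respected all
-- identities of B would not depend on the depth (pad terms by idempotence), so that the
-- condition would be trivial. By compactness finitely many identities of B exclude all
-- assignments. Composing the symbols in them, as often as they are deep, gives a term t and
-- finitely many equations t(u) = t(v) in two letters such that the letters of u and v differ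
-- in every place of t for some equation; an equation is responsible for one class of places.
--
-- Such an equation relaxes membership in relations generated by columns of letters: when the
-- element t(u) = t(v) fills two coordinates, the remaining coordinates are free in the places
-- of its class. With four or more equations, two classes and the remaining ones are handled
-- separately and merged; three equations are reduced to two by a similar argument. From two
-- equations we get a term with four labellings of equal value and no constant column, and from
-- it two elements that mutually dominate each other in the relation NAE₃ generated by the
-- nonconstant triples of letters, whence a constant triple in NAE₃, which is Olšák's term.

module Submission where

open import Defs
open import Function.Bundles using (_⇔_; mk⇔; Equivalence)
open import Data.Bool.Base using (Bool; true; false; not; _∧_; _∨_; _xor_; if_then_else_; T)
open import Data.Bool.Properties using (T-∧; T-∨)
open import Data.Empty using (⊥; ⊥-elim)
open import Data.Fin.Base using (Fin; zero; suc; toℕ; combine; remQuot)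
open import Data.Fin.Patterns using (0F; 1F; 2F; 3F; 4F; 5F)
open import Data.Fin.Properties using (toℕ-injective; remQuot-combine)
open import Data.List.Base using (List; []; _∷_; _++_; map; concatMap; allFin; upTo; cartesianProduct)
open import Data.List.Membership.Propositional using (_∈_; find)
open import Data.List.Membership.Propositional.Properties
  using (∈-map⁺; ∈-allFin; ∈-++⁺ˡ; ∈-++⁺ʳ; ∈-concatMap⁺; ∈-upTo⁺; ∈-cartesianProduct⁺)
open import Data.List.Relation.Binary.Subset.Propositional using () renaming (_⊆_ to _⊑_)
open import Data.List.Relation.Unary.All as All using (All; []; _∷_)
open import Data.List.Relation.Unary.All.Properties using (++⁻ˡ; ++⁻ʳ; ¬All⇒Any¬)
open import Data.List.Relation.Unary.Any as Any using (here; there)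
open import Data.Nat.Base using (ℕ; zero; suc; _+_; _*_; _⊔_; _≤_; _<_; z≤n; s≤s)
open import Data.Nat.Properties using (_≟_; m≤m⊔n; m≤n⊔m; ≤-refl)
open import Data.Product using (Σ; Σ-syntax; _×_; _,_; proj₁; proj₂)
open import Data.Sum.Base using (_⊎_; inj₁; inj₂)
open import Data.Unit.Base using (⊤; tt)
open import Data.Vec.Base using (Vec; []; _∷_)
open import Data.Vec.Functional using (Vector) renaming ([] to ◇; _∷_ to _◂_)
open import Function.Base using (_∘_)
open import Level using (Lift; lift) renaming (_⊔_ to _⊔ˡ_)
open import Relation.Binary.Bundles using (Setoid)
open import Relation.Binary.PropositionalEquality as ≡ using (_≡_; _≢_; refl; cong; cong₂; subst)
open import Relation.Nullary using (¬_; Dec; yes; no; does)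
import Relation.Binary.Reasoning.Setoid as SetoidReasoning

-- Letters

≡-or-not : ∀ a b → a ≡ b ⊎ b ≡ not a
≡-or-not true  true  = inj₁ refl
≡-or-not true  false = inj₂ refl
≡-or-not false true  = inj₂ refl
≡-or-not false false = inj₁ refl

xor-irrefl : ∀ a → ¬ T (a xor a)
xor-irrefl true  ()
xor-irrefl false ()

xor-not : ∀ a s → a xor not s ≡ not (a xor s)
xor-not true  s = refl
xor-not false s = refl

Predicate : ℕ → Set
Predicate zero    = Bool
Predicate (suc n) = Bool → Predicate n

everywhere : ∀ n → Predicate n → Bool
everywhere zero    P = P
everywhere (suc n) P = everywhere n (P true) ∧ everywhere n (P false)

Everywhere : ∀ n → Predicate n → Set
Everywhere zero    P = T P
Everywhere (suc n) P = ∀ b → Everywhere n (P b)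

-- Proof by truth table: for a closed tautology `P` the premise evaluates to the unit type, so that
-- `tt` is the whole proof.
check : ∀ n P → T (everywhere n P) → Everywhere n P
check zero    P t       = t
check (suc n) P t true  = check n (P true)  (proj₁ (Equivalence.to (T-∧ {everywhere n (P true)}) t))
check (suc n) P t false = check n (P false) (proj₂ (Equivalence.to (T-∧ {everywhere n (P true)}) t))

infixr 3 _⇒_
_⇒_ : Bool → Bool → Bool
a ⇒ b = not a ∨ b

modus-ponens : ∀ {a b} → T (a ⇒ b) → T a → T b
modus-ponens {true} t _ = t

nae₃ : Bool → Bool → Bool → Bool
nae₃ a b c = (a xor b) ∨ (b xor c)

nae₄ : Bool → Bool → Bool → Bool → Bool
nae₄ a b c d = (a xor b) ∨ nae₃ b c d

Nonconstant : (Fin 4 → Bool) → Set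
Nonconstant v = T (nae₄ (v 0F) (v 1F) (v 2F) (v 3F))

-- Relations on the free algebra generated by columns of letters

module Evaluation {ℓ} {Δ : Signature ℓ} (B : Algebra Δ) where
  open Algebra B
  open Setoid setoid using () renaming (refl to ≈-refl; sym to ≈-sym; trans to ≈-trans)

  eval-cong : ∀ {X : Set} {ρ ρ′ : X → Carrier} → (∀ a → ρ a ≈ ρ′ a) →
              ∀ t → eval B ρ t ≈ eval B ρ′ t
  eval-cong e (var a)    = e a
  eval-cong e (app f ts) = op-cong f (λ i → eval-cong e (ts i))

  eval-[] : ∀ {X Y : Set} (ρ : Y → Carrier) (σ : X → Term Δ Y) t →
            eval B ρ (t [ σ ]) ≈ eval B (λ a → eval B ρ (σ a)) t
  eval-[] ρ σ (var a)    = ≈-refl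
  eval-[] ρ σ (app f ts) = op-cong f (λ i → eval-[] ρ σ (ts i))

module Idempotent {ℓ} {Δ : Signature ℓ} (B : Algebra Δ)
  (idempotent : ∀ f a → Algebra._≈_ B (Algebra.op B f (λ _ → a)) a) where
  open Algebra B
  open Setoid setoid using () renaming (refl to ≈-refl; sym to ≈-sym; trans to ≈-trans)
  open Evaluation B
  open SetoidReasoning setoid

  eval-const : ∀ {X : Set} a (t : Term Δ X) → eval B (λ _ → a) t ≈ a
  eval-const a (var _)    = ≈-refl
  eval-const a (app f ts) = ≈-trans (op-cong f (λ i → eval-const a (ts i))) (idempotent f a)

  -- The free algebra on the letters true and false, as terms up to evaluation in B.
  F : Set ℓ
  F = Term Δ Bool

  -- One element `a` can be a value of `t` in several ways, and the arguments below pair different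
  -- writings of the same element. Being a record, the relation lets `σ` and `a` be inferred.
  record _⟨_⟩↦_ {Y : Set} (t : Term Δ Y) (σ : Y → F) (a : F) : Set ℓ where
    constructor value
    field
      at : ∀ ρ → eval B (λ i → eval B ρ (σ i)) t ≈ eval B ρ a

  open _⟨_⟩↦_

  ↦-[] : ∀ {Y : Set} (t : Term Δ Y) (σ : Y → F) → t ⟨ σ ⟩↦ (t [ σ ])
  ↦-[] t σ = value λ ρ → ≈-sym (eval-[] ρ σ t)

  ↦-const : ∀ {Y : Set} (t : Term Δ Y) {a} → t ⟨ (λ _ → a) ⟩↦ a
  ↦-const t = value λ ρ → eval-const _ t

  ↦-var : ∀ a → a ⟨ var ⟩↦ a
  ↦-var a = value λ ρ → ≈-refl

  -- No projection satisfies all the equations: the one indexed by `class i` excludes the projection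
  -- to place `i`.
  record Taylor (K : Set) : Set (Level.suc Level.zero ⊔ˡ ℓ) where
    field
      {Place}    : Set
      term       : Term Δ Place
      left right : K → Place → Bool
      balanced   : ∀ k ρ → eval B (ρ ∘ left k) term ≈ eval B (ρ ∘ right k) term
      class      : Place → K
      differs    : ∀ i → T (left (class i) i xor right (class i) i)

    side : K → (Bool → F) → F
    side k a = term [ a ∘ left k ]

    ↦-left : ∀ k a → term ⟨ a ∘ left k ⟩↦ side k a
    ↦-left k a = ↦-[] term (a ∘ left k)

    ↦-right : ∀ k a → term ⟨ a ∘ right k ⟩↦ side k a
    ↦-right k a = value λ ρ → ≈-trans (≈-sym (balanced k (λ b → eval B ρ (a b)))) (at (↦-left k a) ρ)

  Compatible : (F → F → F → Set ℓ) → Set (Level.suc Level.zero ⊔ˡ ℓ)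
  Compatible Q = ∀ {Y : Set} (t : Term Δ Y) {σ₁ σ₂ σ₃ a₁ a₂ a₃} →
    t ⟨ σ₁ ⟩↦ a₁ → t ⟨ σ₂ ⟩↦ a₂ → t ⟨ σ₃ ⟩↦ a₃ →
    (∀ i → Q (σ₁ i) (σ₂ i) (σ₃ i)) → Q a₁ a₂ a₃

  -- An element a with a sign, a : Bool → F, stands for an element of F and its image under the
  -- exchange of the letters.
  module _ {K : Set} (τ : Taylor K) {Q : F → F → F → Set ℓ} (compatible : Compatible Q)
    (a : K → Bool → F)
    (opposite  : ∀ k s w → Q (a k s) (a k (not s)) w)
    (dominates : ∀ k k′ → k ≢ k′ → ∀ s r → Q (a k s) (a k s) (a k′ r)) where
    open Taylor τ

    private
      q : Place → F
      q i = side (class i) (a (class i))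

    loop : F
    loop = term [ q ]

    -- In the places of class k the arguments of the two writings of side k (a k) are opposite;
    -- in all others a k meets a value of some other a k′.
    side-loop : ∀ k → Q (side k (a k)) (side k (a k)) loop
    side-loop k = compatible term (↦-left k (a k)) (↦-right k (a k)) (↦-[] term q) column
      where
      column : ∀ i → Q (a k (left k i)) (a k (right k i)) (q i)
      column i with ≡-or-not (left k i) (right k i)
      ... | inj₂ r≡¬l = subst (λ b → Q (a k (left k i)) (a k b) (q i)) (≡.sym r≡¬l)
                          (opposite k (left k i) (q i))
      ... | inj₁ l≡r  = subst (λ b → Q (a k (left k i)) (a k b) (q i)) l≡r
                          (compatible term (↦-const term) (↦-const term) (↦-left (class i) (a (class i)))
                            (λ j → dominates k (class i) k≢class _ _))
        where
        k≢class : k ≢ class i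
        k≢class refl = xor-irrefl (right k i) (subst (λ b → T (b xor right k i)) l≡r (differs i))

    -- The first two coordinates are written as the term at `q`, the last one as a constant; place
    -- by place this is `side-loop`.
    Q-loop : Q loop loop loop
    Q-loop = compatible term (↦-[] term q) (↦-[] term q) (↦-const term) (λ i → side-loop (class i))

  -- Rel Ok is the compatible relation generated by the columns of letters that satisfy Ok.
  record Rel {K : Set} (Ok : (K → Bool) → Bool) (a : K → F) : Set ℓ where
    constructor rel
    field
      term   : Term Δ (Σ[ v ∈ (K → Bool) ] T (Ok v))
      values : ∀ k ρ → eval B (λ v → ρ (proj₁ v k)) term ≈ eval B ρ (a k)

  closed : ∀ {K : Set} {Ok : (K → Bool) → Bool} {a : K → F} {Y : Set} (t : Term Δ Y) (σ : Y → K → F) →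
           (∀ k → t ⟨ (λ i → σ i k) ⟩↦ a k) → (∀ i → Rel Ok (σ i)) → Rel Ok a
  closed t σ val h = rel (t [ (λ i → Rel.term (h i)) ]) λ k ρ →
    ≈-trans (eval-[] _ _ t) (≈-trans (eval-cong (λ i → Rel.values (h i) k ρ) t) (at (val k) ρ))

  private
    tuple₃ : F → F → F → Fin 3 → F
    tuple₃ a b c = a ◂ b ◂ c ◂ ◇

    tuple₄ : F → F → F → F → Fin 4 → F
    tuple₄ a b c d = a ◂ b ◂ c ◂ d ◂ ◇

  module Quaternary (Ok : (Fin 4 → Bool) → Bool) where
    R : F → F → F → F → Set ℓ
    R a b c d = Rel Ok (tuple₄ a b c d)

    closed₄ : ∀ {Y : Set} (t : Term Δ Y) {σ₁ σ₂ σ₃ σ₄ a₁ a₂ a₃ a₄} →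
              t ⟨ σ₁ ⟩↦ a₁ → t ⟨ σ₂ ⟩↦ a₂ → t ⟨ σ₃ ⟩↦ a₃ → t ⟨ σ₄ ⟩↦ a₄ →
              (∀ i → R (σ₁ i) (σ₂ i) (σ₃ i) (σ₄ i)) → R a₁ a₂ a₃ a₄
    closed₄ t {σ₁} {σ₂} {σ₃} {σ₄} v₁ v₂ v₃ v₄ = closed t (λ i → tuple₄ (σ₁ i) (σ₂ i) (σ₃ i) (σ₄ i)) λ where
      0F → v₁
      1F → v₂
      2F → v₃
      3F → v₄

    letters₄ : ∀ a b c d → T (Ok (a ◂ b ◂ c ◂ d ◂ ◇)) → R (var a) (var b) (var c) (var d)
    letters₄ a b c d ok = rel (var (a ◂ b ◂ c ◂ d ◂ ◇ , ok)) λ where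
      0F ρ → ≈-refl
      1F ρ → ≈-refl
      2F ρ → ≈-refl
      3F ρ → ≈-refl

  NAE₃ : F → F → F → Set ℓ
  NAE₃ a b c = Rel (λ v → nae₃ (v 0F) (v 1F) (v 2F)) (tuple₃ a b c)

  NAE₃-compatible : Compatible NAE₃
  NAE₃-compatible t {σ₁} {σ₂} {σ₃} v₁ v₂ v₃ = closed t (λ i → tuple₃ (σ₁ i) (σ₂ i) (σ₃ i)) λ where
    0F → v₁
    1F → v₂
    2F → v₃

  NAE₃-letters : ∀ a b c → T (nae₃ a b c) → NAE₃ (var a) (var b) (var c)
  NAE₃-letters a b c ok = rel (var (a ◂ b ◂ c ◂ ◇ , ok)) λ where
    0F ρ → ≈-refl
    1F ρ → ≈-refl
    2F ρ → ≈-refl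

  NAE₃-rotate : ∀ {a b c} → NAE₃ a b c → NAE₃ c a b
  NAE₃-rotate (rel t val) = rel (t [ (λ v → var (rotate v)) ]) λ where
      0F ρ → ≈-trans (eval-[] _ _ t) (val 2F ρ)
      1F ρ → ≈-trans (eval-[] _ _ t) (val 0F ρ)
      2F ρ → ≈-trans (eval-[] _ _ t) (val 1F ρ)
    where
    rotate-nae₃ : ∀ a b c → T (nae₃ a b c) → T (nae₃ c a b)
    rotate-nae₃ a b c = modus-ponens (check 3 (λ a b c → nae₃ a b c ⇒ nae₃ c a b) tt a b c)

    rotate : Σ[ v ∈ (Fin 3 → Bool) ] T (nae₃ (v 0F) (v 1F) (v 2F)) →
             Σ[ v ∈ (Fin 3 → Bool) ] T (nae₃ (v 0F) (v 1F) (v 2F))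
    rotate (v , ok) = (v 2F ◂ v 0F ◂ v 1F ◂ ◇) , rotate-nae₃ (v 0F) (v 1F) (v 2F) ok

  Opposite : F → F → Set ℓ
  Opposite a b = ∀ w → NAE₃ a b w

  opposite-letters : ∀ b → Opposite (var b) (var (not b))
  opposite-letters b w =
    NAE₃-compatible w (↦-const w) (↦-const w) (↦-var w)
      (λ c → NAE₃-letters b (not b) c (check 2 (λ b c → nae₃ b (not b) c) tt b c))

  opposite-closed : ∀ {Y : Set} (t : Term Δ Y) {σ₁ σ₂ a₁ a₂} → t ⟨ σ₁ ⟩↦ a₁ → t ⟨ σ₂ ⟩↦ a₂ →
                    (∀ i → Opposite (σ₁ i) (σ₂ i)) → Opposite a₁ a₂
  opposite-closed t v₁ v₂ opp w = NAE₃-compatible t v₁ v₂ (↦-const t) (λ i → opp i w)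

  module NAE₄ = Quaternary (λ v → nae₄ (v 0F) (v 1F) (v 2F) (v 3F))

  -- From two equations to a loop in `NAE₃`

  module _ (τ : Taylor (Fin 2)) where
    open Taylor τ
    open NAE₄

    private
      flip : Bool → Bool → F
      flip s b = var (b xor s)

      a : Fin 2 → Bool → F
      a k s = side k (flip s)

      opposite : ∀ k s w → R (a k s) (a k (not s)) w w
      opposite k s w = closed₄ term (↦-left k (flip s)) (↦-left k (flip (not s))) (↦-const term) (↦-const term) λ i →
        closed₄ w (↦-const w) (↦-const w) (↦-var w) (↦-var w) λ c →
        letters₄ _ _ c c (check 3 (λ b s c → nae₄ (b xor s) (b xor not s) c c) tt (left k i) s c)

      differ : ∀ k k′ → k ≢ k′ → ∀ i → T ((left k i xor right k i) ∨ (left k′ i xor right k′ i))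
      differ 0F 0F n i = ⊥-elim (n refl)
      differ 1F 1F n i = ⊥-elim (n refl)
      differ 0F 1F n i with class i | differs i
      ... | 0F | d = Equivalence.from T-∨ (inj₁ d)
      ... | 1F | d = Equivalence.from T-∨ (inj₂ d)
      differ 1F 0F n i with class i | differs i
      ... | 0F | d = Equivalence.from T-∨ (inj₂ d)
      ... | 1F | d = Equivalence.from T-∨ (inj₁ d)

      -- Each element is written by both sides of its own equation. Every place belongs to one of
      -- the two classes, so one of the two pairs of letters differs there.
      dominates : ∀ k k′ → k ≢ k′ → ∀ s r → R (a k s) (a k s) (a k′ r) (a k′ r)
      dominates k k′ k≢k′ s r =
        closed₄ term (↦-left k (flip s)) (↦-right k (flip s)) (↦-left k′ (flip r)) (↦-right k′ (flip r)) λ i →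
        letters₄ _ _ _ _ (shift (left k i) (right k i) (left k′ i) (right k′ i) (differ k k′ k≢k′ i))
        where
        shift : ∀ a b c d → T ((a xor b) ∨ (c xor d)) → T (nae₄ (a xor s) (b xor s) (c xor r) (d xor r))
        shift a b c d = modus-ponens (check 6 (λ a b c d s r →
          (a xor b) ∨ (c xor d) ⇒ nae₄ (a xor s) (b xor s) (c xor r) (d xor r)) tt a b c d s r)

    nae₄-loop : Σ[ w ∈ F ] R w w w w
    nae₄-loop = _ , Q-loop τ {Q = λ u v w → R u v w w}
      (λ t v₁ v₂ v₃ → closed₄ t v₁ v₂ v₃ v₃) a opposite dominates

    private
      Column : Set
      Column = Σ[ v ∈ (Fin 4 → Bool) ] Nonconstant v

      row : Fin 4 → Column → Bool
      row k c = proj₁ c k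

      f : Term Δ Column
      f = Rel.term (proj₂ nae₄-loop)

      rows-agree : ∀ k ρ → eval B (ρ ∘ row k) f ≈ eval B ρ (proj₁ nae₄-loop)
      rows-agree 0F = Rel.values (proj₂ nae₄-loop) 0F
      rows-agree 1F = Rel.values (proj₂ nae₄-loop) 1F
      rows-agree 2F = Rel.values (proj₂ nae₄-loop) 2F
      rows-agree 3F = Rel.values (proj₂ nae₄-loop) 3F

      -- Letters are replaced through `g`, after an exchange if `s` is `true`. The rows of `f` have
      -- equal values, so `↦-insertion` can write this element by any row, not only by row 0.
      insertion : (Bool → F) → Bool → F
      insertion g s = f [ (λ c → g (row 0F c xor s)) ]

      ↦-insertion : ∀ g k s → f ⟨ (λ c → g (row k c xor s)) ⟩↦ insertion g s
      ↦-insertion g k s = value λ ρ → begin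
        eval B (λ c → eval B ρ (g (row k c xor s))) f   ≈⟨ rows-agree k (λ b → eval B ρ (g (b xor s))) ⟩
        eval B (λ b → eval B ρ (g (b xor s))) (proj₁ nae₄-loop)
                                                        ≈⟨ rows-agree 0F (λ b → eval B ρ (g (b xor s))) ⟨
        eval B (λ c → eval B ρ (g (row 0F c xor s))) f  ≈⟨ eval-[] ρ _ f ⟨
        eval B ρ (insertion g s)                        ∎

      opposite-flip : ∀ {g : Bool → F} → (∀ b → Opposite (g b) (g (not b))) →
                      ∀ a s → Opposite (g (a xor s)) (g (a xor not s))
      opposite-flip {g} opp a s = subst (λ b → Opposite (g (a xor s)) (g b)) (≡.sym (xor-not a s)) (opp (a xor s))

      opposite-insertion : ∀ {g : Bool → F} → (∀ b → Opposite (g b) (g (not b))) →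
                           ∀ b → Opposite (insertion g b) (insertion g (not b))
      opposite-insertion {g} opp s = opposite-closed f (↦-insertion g 0F s) (↦-insertion g 0F (not s))
        λ c → opposite-flip {g} opp (row 0F c) s

      δ δ′ : Bool → F
      δ  = insertion var
      δ′ = insertion δ

      δ-opposite : ∀ b → Opposite (δ b) (δ (not b))
      δ-opposite = opposite-insertion opposite-letters

      -- The first two cases agree in a nonconstant column, where a = b and c = d force c = not a.
      -- The value in the remaining cases is the one that makes ν-apart hold.
      mix : Bool → Bool → Bool → Bool → Bool
      mix a b c d = if not (a xor b) then not a else
                    if not (c xor d) then c else
                    if not (a xor c) then not a else a

      -- The index `j` runs through the three ways to split the four rows into two pairs; row 0 is
      -- paired with row `suc j`.
      mixed : Fin 3 → (Fin 4 → Bool) → Bool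
      mixed 0F v = mix (v 0F) (v 1F) (v 2F) (v 3F)
      mixed 1F v = mix (v 0F) (v 2F) (v 3F) (v 1F)
      mixed 2F v = mix (v 0F) (v 3F) (v 1F) (v 2F)

      ν : Fin 3 → Bool → F
      ν j s = f [ (λ c → var (mixed j (proj₁ c) xor s)) ]

      rotate₄ : ∀ a b c d → T (nae₄ a b c d) → T (nae₄ a c d b)
      rotate₄ a b c d = modus-ponens (check 4 (λ a b c d → nae₄ a b c d ⇒ nae₄ a c d b) tt a b c d)

      turned₁ : ∀ (v : Fin 4 → Bool) → Nonconstant v → T (nae₄ (v 0F) (v 2F) (v 3F) (v 1F))
      turned₁ v = rotate₄ (v 0F) (v 1F) (v 2F) (v 3F)

      turned₂ : ∀ (v : Fin 4 → Bool) → Nonconstant v → T (nae₄ (v 0F) (v 3F) (v 1F) (v 2F))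
      turned₂ v ok = rotate₄ (v 0F) (v 2F) (v 3F) (v 1F) (turned₁ v ok)

      near : ∀ a b c d s → T (nae₄ a b c d) → T (nae₃ (a xor s) (b xor s) (mix a b c d xor s))
      near a b c d s = modus-ponens (check 5 (λ a b c d s →
        nae₄ a b c d ⇒ nae₃ (a xor s) (b xor s) (mix a b c d xor s)) tt a b c d s)

      far : ∀ a b c d s → T (nae₄ a b c d) → T (nae₃ (c xor s) (d xor s) (mix a b c d xor not s))
      far a b c d s = modus-ponens (check 5 (λ a b c d s →
        nae₄ a b c d ⇒ nae₃ (c xor s) (d xor s) (mix a b c d xor not s)) tt a b c d s)

      -- For equal signs `δ s` is written by rows 0 and `suc j`: where they agree, `mix` is the
      -- other letter. For different signs it is written by the other two rows: where they agree,
      -- `mix` is their letter, and the change of sign separates them.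
      δ-below-ν : ∀ j s t → NAE₃ (δ s) (δ s) (ν j t)
      δ-below-ν j s t with ≡-or-not s t
      ... | inj₁ refl = NAE₃-compatible f (↦-insertion var 0F s) (↦-insertion var (suc j) s) (↦-[] f _)
                          λ (v , ok) → NAE₃-letters _ _ _ (column j v ok)
        where
        column : ∀ j v → Nonconstant v →
                 T (nae₃ (v 0F xor s) (v (suc j) xor s) (mixed j v xor s))
        column 0F v ok = near (v 0F) (v 1F) (v 2F) (v 3F) s ok
        column 1F v ok = near (v 0F) (v 2F) (v 3F) (v 1F) s (turned₁ v ok)
        column 2F v ok = near (v 0F) (v 3F) (v 1F) (v 2F) s (turned₂ v ok)
      ... | inj₂ refl = NAE₃-compatible f (↦-insertion var (third j) s) (↦-insertion var (fourth j) s) (↦-[] f _)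
                          λ (v , ok) → NAE₃-letters _ _ _ (column j v ok)
        where
        third fourth : Fin 3 → Fin 4
        third 0F = 2F
        third 1F = 3F
        third 2F = 1F
        fourth 0F = 3F
        fourth 1F = 1F
        fourth 2F = 2F

        column : ∀ j v → Nonconstant v →
                 T (nae₃ (v (third j) xor s) (v (fourth j) xor s) (mixed j v xor not s))
        column 0F v ok = far (v 0F) (v 1F) (v 2F) (v 3F) s ok
        column 1F v ok = far (v 0F) (v 2F) (v 3F) (v 1F) s (turned₁ v ok)
        column 2F v ok = far (v 0F) (v 3F) (v 1F) (v 2F) s (turned₂ v ok)

      next : ∀ a b c d s → T (nae₄ a b c d) →
             T (nae₃ (mix a b c d xor s) (mix a c d b xor s) (a xor s)) ×
             T (nae₃ (mix a b c d xor s) (mix a c d b xor s) (d xor not s))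
      next a b c d s ok =
        modus-ponens (check 5 (λ a b c d s →
          nae₄ a b c d ⇒ nae₃ (mix a b c d xor s) (mix a c d b xor s) (a xor s)) tt a b c d s) ok ,
        modus-ponens (check 5 (λ a b c d s →
          nae₄ a b c d ⇒ nae₃ (mix a b c d xor s) (mix a c d b xor s) (d xor not s)) tt a b c d s) ok

      previous : ∀ a b c d s → T (nae₄ a b c d) →
                 T (nae₃ (mix a b c d xor s) (mix a d b c xor s) (a xor s)) ×
                 T (nae₃ (mix a b c d xor s) (mix a d b c xor s) (c xor not s))
      previous a b c d s ok =
        modus-ponens (check 5 (λ a b c d s →
          nae₄ a b c d ⇒ nae₃ (mix a b c d xor s) (mix a d b c xor s) (a xor s)) tt a b c d s) ok ,
        modus-ponens (check 5 (λ a b c d s →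
          nae₄ a b c d ⇒ nae₃ (mix a b c d xor s) (mix a d b c xor s) (c xor not s)) tt a b c d s) ok

      remaining : Fin 3 → Fin 3 → Fin 4
      remaining 0F 1F = 3F
      remaining 1F 0F = 3F
      remaining 0F 2F = 2F
      remaining 2F 0F = 2F
      remaining _  _  = 1F

      -- Where `mixed i` and `mixed j` agree, their value differs from row 0 and equals row
      -- `remaining i j`, the one that neither pairs with row 0. The signs decide which of these
      -- rows writes `δ s`.
      ν-apart : ∀ i j → i ≢ j → ∀ s t → NAE₃ (ν i t) (ν j t) (δ s)
      ν-apart i j i≢j s t = pick (≡-or-not t s)
        where
        columns : ∀ i j → i ≢ j → ∀ v → Nonconstant v →
          T (nae₃ (mixed i v xor t) (mixed j v xor t) (v 0F xor t)) ×
          T (nae₃ (mixed i v xor t) (mixed j v xor t) (v (remaining i j) xor not t))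
        columns 0F 0F n v ok = ⊥-elim (n refl)
        columns 1F 1F n v ok = ⊥-elim (n refl)
        columns 2F 2F n v ok = ⊥-elim (n refl)
        columns 0F 1F n v ok = next     (v 0F) (v 1F) (v 2F) (v 3F) t ok
        columns 0F 2F n v ok = previous (v 0F) (v 1F) (v 2F) (v 3F) t ok
        columns 1F 2F n v ok = next     (v 0F) (v 2F) (v 3F) (v 1F) t (turned₁ v ok)
        columns 1F 0F n v ok = previous (v 0F) (v 2F) (v 3F) (v 1F) t (turned₁ v ok)
        columns 2F 0F n v ok = next     (v 0F) (v 3F) (v 1F) (v 2F) t (turned₂ v ok)
        columns 2F 1F n v ok = previous (v 0F) (v 3F) (v 1F) (v 2F) t (turned₂ v ok)

        pick : t ≡ s ⊎ s ≡ not t → NAE₃ (ν i t) (ν j t) (δ s)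
        pick (inj₁ refl) = NAE₃-compatible f (↦-[] f _) (↦-[] f _) (↦-insertion var 0F t)
          λ (v , ok) → NAE₃-letters _ _ _ (proj₁ (columns i j i≢j v ok))
        pick (inj₂ refl) = NAE₃-compatible f (↦-[] f _) (↦-[] f _) (↦-insertion var (remaining i j) (not t))
          λ (v , ok) → NAE₃-letters _ _ _ (proj₂ (columns i j i≢j v ok))

      ν-opposite : ∀ j t → Opposite (ν j t) (ν j (not t))
      ν-opposite j t = opposite-closed f (↦-[] f _) (↦-[] f _)
        λ (v , _) → opposite-flip {var} opposite-letters (mixed j v) t

      split : Column → Fin 3
      split (v , _) = if v 0F xor v 1F then 0F else if v 0F xor v 2F then 1F else 2F

      split-splits : ∀ c → T (row 0F c xor row (suc (split c)) c)
      split-splits (v , ok)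
        with v 0F xor v 1F in e₁ | v 0F xor v 2F in e₂ | first-differs (v 0F) (v 1F) (v 2F) (v 3F) ok
        where
        first-differs : ∀ a b c d → T (nae₄ a b c d) → T ((a xor b) ∨ (a xor c) ∨ (a xor d))
        first-differs a b c d = modus-ponens
          (check 4 (λ a b c d → nae₄ a b c d ⇒ (a xor b) ∨ (a xor c) ∨ (a xor d)) tt a b c d)
      ... | true  | _     | _ = subst T (≡.sym e₁) tt
      ... | false | true  | _ = subst T (≡.sym e₂) tt
      ... | false | false | t = t

      -- Where rows 0 and `suc j` differ, the value of `δ` can be opposed by a suitable row of `δ′`.
      -- Where they agree, `ν j t` is placed, which `δ` of either sign dominates.
      entry : Fin 3 → Bool → Column → F
      entry j t c = if row 0F c xor row (suc j) c then δ (row 0F c xor t) else ν j t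

      ζ : Fin 3 → Bool → F
      ζ j t = f [ entry j t ]

      z : Bool → F
      z t = f [ (λ c → ζ (split c) t) ]

      entry-opposite : ∀ j t c → Opposite (entry j t c) (entry j (not t) c)
      entry-opposite j t c with row 0F c xor row (suc j) c
      ... | true  = opposite-flip {δ} δ-opposite (row 0F c) t
      ... | false = ν-opposite j t

      z-opposite : ∀ t → Opposite (z t) (z (not t))
      z-opposite t = opposite-closed f (↦-[] f _) (↦-[] f _) λ c →
        opposite-closed f (↦-[] f _) (↦-[] f _) λ d → entry-opposite (split c) t d

      δ-opposite-xor : ∀ a b → T (a xor b) → Opposite (δ a) (δ b)
      δ-opposite-xor true  false _ = δ-opposite true
      δ-opposite-xor false true  _ = δ-opposite false

      xor-comm : ∀ a b → T (a xor b) → T (b xor a)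
      xor-comm a b = modus-ponens (check 2 (λ a b → a xor b ⇒ b xor a) tt a b)

      xor-cancel : ∀ a b s → T (a xor b) → T ((a xor s) xor (b xor s))
      xor-cancel a b s = modus-ponens (check 3 (λ a b s → a xor b ⇒ (a xor s) xor (b xor s)) tt a b s)

      δδν : ∀ j a b t → NAE₃ (δ a) (δ b) (ν j t)
      δδν j a b t with ≡-or-not a b
      ... | inj₁ refl = δ-below-ν j a t
      ... | inj₂ refl = δ-opposite a (ν j t)

      δ′-below-z : ∀ r t → NAE₃ (δ′ r) (δ′ r) (z t)
      δ′-below-z r t = NAE₃-compatible f (↦-const f) (↦-const f) (↦-[] f _) λ c → below-ζ (split c)
        where
        -- `δ′ r` is written by rows 0 and `suc j`. Where these differ, they already give opposite
        -- elements; where they agree, the entry of `ζ j t` is `ν j t`.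
        below-ζ : ∀ j → NAE₃ (δ′ r) (δ′ r) (ζ j t)
        below-ζ j = NAE₃-compatible f (↦-insertion δ 0F r) (↦-insertion δ (suc j) r) (↦-[] f _)
                      λ c → column (row 0F c) (row (suc j) c)
          where
          column : ∀ a b → NAE₃ (δ (a xor r)) (δ (b xor r)) (if a xor b then δ (a xor t) else ν j t)
          column true  true  = δδν j _ _ t
          column false false = δδν j _ _ t
          column true  false = δ-opposite-xor _ _ (xor-cancel true false r tt) _
          column false true  = δ-opposite-xor _ _ (xor-cancel false true r tt) _

      -- The row of δ′ r that opposes the entries of ζ j t wherever rows 0 and j + 1 differ.
      against : Fin 3 → Bool → Bool → Fin 4
      against j t r = if t xor r then 0F else suc j

      against-opposes : ∀ j t r c → T (row 0F c xor row (suc j) c) →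
                        T ((row (against j t r) c xor r) xor (row 0F c xor t))
      against-opposes j true  true  c d =
        xor-cancel (row (suc j) c) (row 0F c) true (xor-comm (row 0F c) (row (suc j) c) d)
      against-opposes j true  false c d = check 1 (λ a → (a xor false) xor (a xor true)) tt (row 0F c)
      against-opposes j false true  c d = check 1 (λ a → (a xor true) xor (a xor false)) tt (row 0F c)
      against-opposes j false false c d =
        xor-cancel (row (suc j) c) (row 0F c) false (xor-comm (row 0F c) (row (suc j) c) d)

      z-below-δ′ : ∀ t r → NAE₃ (z t) (z t) (δ′ r)
      z-below-δ′ t r = NAE₃-compatible f (↦-[] f _) (↦-const f) (↦-const f) λ c → ζ-z (split c)
        where
        ν-ζ : ∀ j i → j ≢ i → ∀ s → NAE₃ (ν j t) (ζ i t) (δ s)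
        ν-ζ j i j≢i s = NAE₃-compatible f (↦-const f) (↦-[] f _) (↦-const f) column
          where
          column : ∀ c → NAE₃ (ν j t) (entry i t c) (δ s)
          column c with row 0F c xor row (suc i) c
          ... | true  = NAE₃-rotate (δδν j (row 0F c xor t) s t)
          ... | false = ν-apart j i j≢i s t

        -- Where rows 0 and `suc j` differ, `against` makes the first and third coordinates
        -- opposite. Where they agree, `split c` is an index other than `j`, so that `ν-ζ` applies.
        ζ-z : ∀ j → NAE₃ (ζ j t) (z t) (δ′ r)
        ζ-z j = NAE₃-compatible f (↦-[] f _) (↦-[] f _) (↦-insertion δ (against j t r) r) column
          where
          column : ∀ c → NAE₃ (entry j t c) (ζ (split c) t) (δ (row (against j t r) c xor r))
          column c with row 0F c xor row (suc j) c in e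
          ... | true  = NAE₃-rotate (NAE₃-rotate (δ-opposite-xor _ _ (against-opposes j t r c (subst T (≡.sym e) tt)) _))
          ... | false = ν-ζ j (split c) (λ { refl → subst T e (split-splits c) }) _

    nae₃-loop : Σ[ w ∈ F ] NAE₃ w w w
    nae₃-loop = _ , Q-loop τ NAE₃-compatible pair opposites below
      where
      pair : Fin 2 → Bool → F
      pair 0F = z
      pair 1F = δ′

      opposites : ∀ k s w → NAE₃ (pair k s) (pair k (not s)) w
      opposites 0F = z-opposite
      opposites 1F = opposite-insertion δ-opposite

      below : ∀ k k′ → k ≢ k′ → ∀ s r → NAE₃ (pair k s) (pair k s) (pair k′ r)
      below 0F 0F n = ⊥-elim (n refl)
      below 1F 1F n = ⊥-elim (n refl)
      below 0F 1F n = z-below-δ′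
      below 1F 0F n = δ′-below-z

-- Reducing a Taylor term to two equations

module Reduction {ℓ} {Δ : Signature ℓ} (B : Algebra Δ)
  (idempotent : ∀ f a → Algebra._≈_ B (Algebra.op B f (λ _ → a)) a) where
  open Algebra B
  open Setoid setoid using () renaming (refl to ≈-refl; sym to ≈-sym; trans to ≈-trans)
  open Evaluation B
  open Idempotent B idempotent
  open SetoidReasoning setoid

  -- From three equations to two

  module _ (τ : Taylor (Fin 3)) where
    open Taylor τ
    open Quaternary (λ v → (v 0F xor v 1F) ∨ (v 2F xor v 3F))

    private
      -- A pair with this property exempts the places of one class from any condition.
      Free : F → F → Set ℓ
      Free c d = ∀ a b → R a b c d

      FreePair : (Bool → F) → Set ℓ
      FreePair c = ∀ s → Free (c s) (c (not s))

      free-letters : FreePair var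
      free-letters s a b =
        closed₄ a (↦-var a) (↦-const a) (↦-const a) (↦-const a) λ p →
        closed₄ b (↦-const b) (↦-var b) (↦-const b) (↦-const b) λ q →
        letters₄ p q s (not s) (check 3 (λ p q s → (p xor q) ∨ (s xor not s)) tt p q s)

      record Linked (c : Bool → F) (a b : F) : Set ℓ where
        constructor linked
        field links : ∀ s → R a b (c s) (c s)

      open Linked

      extend : Fin 3 → (Bool → F) → Bool → F
      extend k c s = side k (λ b → c (b xor s))

      free-extend : ∀ k {c} → FreePair c → FreePair (extend k c)
      free-extend k {c} free s a b =
        closed₄ term (↦-const term) (↦-const term) (↦-left k (λ b → c (b xor s))) (↦-left k (λ b → c (b xor not s))) λ i →
        subst (λ e → R a b (c (left k i xor s)) (c e)) (≡.sym (xor-not (left k i) s)) (free (left k i xor s) a b)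

      free-xor : ∀ (c : Bool → F) → FreePair c → ∀ p q → T (p xor q) → Free (c p) (c q)
      free-xor c free true  false _ = free true
      free-xor c free false true  _ = free false

      -- The last two coordinates are filled by the two sides of equation `k`. Where their letters
      -- differ, they form a free pair; where they agree, the place lies outside class `k` and the
      -- given link applies.
      absorb : ∀ k {c} → FreePair c → ∀ {σ σ′ a b} → term ⟨ σ ⟩↦ a → term ⟨ σ′ ⟩↦ b →
               (∀ i → class i ≢ k → Linked c (σ i) (σ′ i)) → Linked (extend k c) a b
      absorb k {c} free {σ} {σ′} v v′ link = linked λ s →
        closed₄ term v v′ (↦-left k (λ b → c (b xor s))) (↦-right k (λ b → c (b xor s))) (column s)
        where
        column : ∀ s i → R (σ i) (σ′ i) (c (left k i xor s)) (c (right k i xor s))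
        column s i with ≡-or-not (left k i) (right k i)
        ... | inj₂ e = free-xor c free _ _ (opposed (left k i) (right k i) e) (σ i) (σ′ i)
          where
          opposed : ∀ p q → q ≡ not p → T ((p xor s) xor (q xor s))
          opposed p _ refl = check 2 (λ p s → (p xor s) xor (not p xor s)) tt p s
        ... | inj₁ e = subst (λ q → R (σ i) (σ′ i) (c (left k i xor s)) (c (q xor s))) e
                         (links (link i other) (left k i xor s))
          where
          other : class i ≢ k
          other refl = xor-irrefl (right k i) (subst (λ p → T (p xor right k i)) e (differs i))

      keep : ∀ k {c} → FreePair c → ∀ {a b} → Linked c a b → Linked (extend k c) a b
      keep k free link = absorb k free (↦-const term) (↦-const term) (λ _ _ → link)

      -- Running through all three equations makes the new pair the same whichever class is
      -- absorbed, so that links obtained by absorbing different classes can be combined.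
      extend-all : (Bool → F) → Bool → F
      extend-all c = extend 2F (extend 1F (extend 0F c))

      module _ {c} (free : FreePair c) where
        free₁ : FreePair (extend 0F c)
        free₁ = free-extend 0F free

        free₂ : FreePair (extend 1F (extend 0F c))
        free₂ = free-extend 1F free₁

        free-extend-all : FreePair (extend-all c)
        free-extend-all = free-extend 2F free₂

        keep-all : ∀ {a b} → Linked c a b → Linked (extend-all c) a b
        keep-all link = keep 2F free₂ (keep 1F free₁ (keep 0F free link))

        absorb-all : ∀ k {σ σ′ a b} → term ⟨ σ ⟩↦ a → term ⟨ σ′ ⟩↦ b →
                     (∀ i → class i ≢ k → Linked c (σ i) (σ′ i)) → Linked (extend-all c) a b
        absorb-all 0F v v′ link = keep 2F free₂ (keep 1F free₁ (absorb 0F free v v′ link))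
        absorb-all 1F v v′ link = keep 2F free₂ (absorb 1F free₁ v v′ λ i n → keep 0F free (link i n))
        absorb-all 2F v v′ link = absorb 2F free₂ v v′ λ i n → keep 1F free₁ (keep 0F free (link i n))

      -- Any two of these labellings of the classes agree in exactly one class.
      label : Fin 3 → Fin 3 → Bool
      label 0F _  = true
      label 1F 0F = true
      label 1F _  = false
      label 2F 1F = true
      label 2F _  = false

      agreement : Fin 3 → Fin 3 → Fin 3
      agreement 0F 1F = 0F
      agreement 1F 0F = 0F
      agreement 0F 2F = 1F
      agreement 2F 0F = 1F
      agreement _  _  = 2F

      label-differs : ∀ i j → i ≢ j → ∀ k → k ≢ agreement i j → T (label i k xor label j k)
      label-differs 0F 0F n k m = ⊥-elim (n refl)
      label-differs 1F 1F n k m = ⊥-elim (n refl)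
      label-differs 2F 2F n k m = ⊥-elim (n refl)
      label-differs 0F 1F n 0F m = ⊥-elim (m refl)
      label-differs 0F 1F n 1F m = tt
      label-differs 0F 1F n 2F m = tt
      label-differs 0F 2F n 0F m = tt
      label-differs 0F 2F n 1F m = ⊥-elim (m refl)
      label-differs 0F 2F n 2F m = tt
      label-differs 1F 0F n 0F m = ⊥-elim (m refl)
      label-differs 1F 0F n 1F m = tt
      label-differs 1F 0F n 2F m = tt
      label-differs 1F 2F n 0F m = tt
      label-differs 1F 2F n 1F m = tt
      label-differs 1F 2F n 2F m = ⊥-elim (m refl)
      label-differs 2F 0F n 0F m = tt
      label-differs 2F 0F n 1F m = ⊥-elim (m refl)
      label-differs 2F 0F n 2F m = tt
      label-differs 2F 1F n 0F m = tt
      label-differs 2F 1F n 1F m = tt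
      label-differs 2F 1F n 2F m = ⊥-elim (m refl)

      corner : Fin 3 → F
      corner j = term [ (λ i → var (label j (class i))) ]

      apex : F
      apex = term [ corner ∘ class ]

      c₁ c₂ c₃ : Bool → F
      c₁ = extend-all var
      c₂ = extend-all c₁
      c₃ = extend-all c₂

      corners-linked : ∀ i j → i ≢ j → Linked c₁ (corner i) (corner j)
      corners-linked i j i≢j = absorb-all free-letters (agreement i j) (↦-[] term _) (↦-[] term _) λ p n →
        linked λ s → letters₄ _ _ s s (Equivalence.from T-∨ (inj₁ (label-differs i j i≢j (class p) n)))

      -- Outside class `j` the arguments of `apex` are corners other than `corner j`; class `j`
      -- itself is absorbed.
      apex-corner : ∀ j → Linked c₂ apex (corner j)
      apex-corner j = absorb-all (free-extend-all free-letters) j (↦-[] term _) (↦-const term)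
        λ p n → corners-linked (class p) j n

      -- Nothing is left to absorb: in place `p` the constant `apex` faces `corner (class p)`, to
      -- which it is linked.
      apex-apex : R apex apex (c₂ true) (c₂ true)
      apex-apex = closed₄ term (↦-const term) (↦-[] term _) (↦-const term) (↦-const term)
        λ p → links (apex-corner (class p)) true

      rows : Fin 4 → Fin 4 → Fin 2 → (Fin 4 → Bool) → Bool
      rows i j 0F v = v i
      rows i j 1F v = v j

    taylor₂ : Taylor (Fin 2)
    taylor₂ = record
      { term     = Rel.term apex-apex
      ; left     = λ k v → rows 0F 2F k (proj₁ v)
      ; right    = λ k v → rows 1F 3F k (proj₁ v)
      ; balanced = λ where
          0F ρ → ≈-trans (Rel.values apex-apex 0F ρ) (≈-sym (Rel.values apex-apex 1F ρ))
          1F ρ → ≈-trans (Rel.values apex-apex 2F ρ) (≈-sym (Rel.values apex-apex 3F ρ))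
      ; class    = λ v → if proj₁ v 0F xor proj₁ v 1F then 0F else 1F
      ; differs  = λ (v , ok) → differing v ok
      }
      where
      differing : ∀ (v : Fin 4 → Bool) → T ((v 0F xor v 1F) ∨ (v 2F xor v 3F)) →
        let k = if v 0F xor v 1F then 0F else 1F in T (rows 0F 2F k v xor rows 1F 3F k v)
      differing v ok with v 0F xor v 1F in e
      ... | true  = subst T (≡.sym e) tt
      ... | false = ok

  -- Places are triples of places. With A the set of places outside the first two classes,
  -- the first pair of rows is the value z of T(A) written as T(z, …, z) = T(A); at a place of
  -- the outermost T it becomes the pair (z, true) or (z, false), which the other pairs, read
  -- from the two inner copies of T, take care of.
  module Merge {n} (τ : Taylor (Fin (4 + n))) where
    open Taylor τ

    private
      inside : Fin (4 + n) → Bool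
      inside zero          = false
      inside (suc zero)    = false
      inside (suc (suc _)) = true

      A : Place → Bool
      A i = inside (class i)

      -- Equation `suc s` treats class `outer s` in the middle copy of the term and class `inner s`
      -- in the innermost one. There are at least two such `s`, so both of the first two classes
      -- occur as `inner s`.
      outer inner : Fin (2 + n) → Fin (4 + n)
      outer s       = suc (suc s)
      inner zero    = zero
      inner (suc _) = suc zero

      cube : Term Δ (Place × Place × Place)
      cube = term [ (λ i → term [ (λ j → term [ (λ k → var (i , j , k)) ]) ]) ]

      eval-cube : ∀ ρ → eval B ρ cube ≈
        eval B (λ i → eval B (λ j → eval B (λ k → ρ (i , j , k)) term) term) term
      eval-cube ρ = ≈-trans (eval-[] ρ _ term) (eval-cong (λ i →
        ≈-trans (eval-[] ρ _ term) (eval-cong (λ j → eval-[] ρ _ term) term)) term)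

      left′ right′ : Fin (3 + n) → Place × Place × Place → Bool
      left′  zero    (i , j , k) = if A i then A j else A k
      -- By the `xor` one copy can switch the sides of its equation while the letter from the other
      -- copy acts as a fixed shift.
      left′  (suc s) (i , j , k) = left (inner s) k xor left (outer s) j
      right′ zero    (i , j , k) = A i
      right′ (suc s) (i , j , k) =
        if A i then left (inner s) k xor right (outer s) j else right (inner s) k xor left (outer s) j

      balanced′ : ∀ k ρ → eval B (ρ ∘ left′ k) cube ≈ eval B (ρ ∘ right′ k) cube
      balanced′ zero ρ = begin
        eval B (ρ ∘ left′ zero) cube                             ≈⟨ eval-cube _ ⟩
        eval B (λ i → eval B (λ j → eval B (λ k → ρ (if A i then A j else A k)) term) term) term
                                                                 ≈⟨ eval-cong (λ i → branch (A i)) term ⟩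
        eval B (λ i → eval B (ρ ∘ A) term) term                  ≈⟨ eval-const _ term ⟩
        eval B (ρ ∘ A) term                                      ≈⟨ eval-cong (λ i →
          ≈-trans (eval-cong (λ j → eval-const _ term) term) (eval-const _ term)) term ⟨
        eval B (λ i → eval B (λ j → eval B (λ k → ρ (A i)) term) term) term
                                                                 ≈⟨ eval-cube _ ⟨
        eval B (ρ ∘ right′ zero) cube                            ∎
        where
        branch : ∀ b → eval B (λ j → eval B (λ k → ρ (if b then A j else A k)) term) term ≈ eval B (ρ ∘ A) term
        branch true  = eval-cong (λ j → eval-const _ term) term
        branch false = eval-const _ term
      balanced′ (suc s) ρ = ≈-trans (eval-cube _) (≈-trans (eval-cong (λ i → branch (A i)) term) (≈-sym (eval-cube _)))
        where
        l = left (inner s)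
        branch : ∀ b → eval B (λ j → eval B (λ k → ρ (l k xor left (outer s) j)) term) term ≈
          eval B (λ j → eval B (λ k →
            ρ (if b then l k xor right (outer s) j else right (inner s) k xor left (outer s) j)) term) term
        branch true  = balanced (outer s) (λ b → eval B (λ k → ρ (l k xor b)) term)
        branch false = eval-cong (λ j → balanced (inner s) (λ b → ρ (b xor left (outer s) j))) term

      Differing : Place × Place × Place → Set
      Differing p = Σ[ k ∈ Fin (3 + n) ] T (left′ k p xor right′ k p)

      differing : ∀ p → Differing p
      differing (i , j , k) = at-outermost (A i) refl
        where
        cancelˡ : ∀ p a b → T (a xor b) → T ((p xor a) xor (p xor b))
        cancelˡ p a b = modus-ponens (check 3 (λ p a b → a xor b ⇒ (p xor a) xor (p xor b)) tt p a b)

        cancelʳ : ∀ p a b → T (a xor b) → T ((a xor p) xor (b xor p))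
        cancelʳ p a b = modus-ponens (check 3 (λ p a b → a xor b ⇒ (a xor p) xor (b xor p)) tt p a b)

        differs-at : ∀ c p → class p ≡ c → T (left c p xor right c p)
        differs-at c p refl = differs p

        first : ∀ b → A i ≡ b → T ((if b then A j else A k) xor b) → Differing (i , j , k)
        first b e t = zero , subst (λ b → T ((if b then A j else A k) xor b)) (≡.sym e) t

        later : ∀ b s → A i ≡ b →
          T ((left (inner s) k xor left (outer s) j) xor
             (if b then left (inner s) k xor right (outer s) j else right (inner s) k xor left (outer s) j)) →
          Differing (i , j , k)
        later b s e t = suc s , subst (λ b → T ((left (inner s) k xor left (outer s) j) xor
          (if b then left (inner s) k xor right (outer s) j else right (inner s) k xor left (outer s) j))) (≡.sym e) t

        at-middle : A i ≡ true → ∀ c → class j ≡ c → Differing (i , j , k)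
        at-middle e zero          f = first true e (subst (λ c → T (inside c xor true)) (≡.sym f) tt)
        at-middle e (suc zero)    f = first true e (subst (λ c → T (inside c xor true)) (≡.sym f) tt)
        at-middle e (suc (suc s)) f = later true s e
          (cancelˡ (left (inner s) k) (left (outer s) j) (right (outer s) j) (differs-at (outer s) j f))

        at-innermost : A i ≡ false → ∀ c → class k ≡ c → Differing (i , j , k)
        at-innermost e zero          f = later false zero e
          (cancelʳ (left (outer zero) j) (left zero k) (right zero k) (differs-at zero k f))
        at-innermost e (suc zero)    f = later false (suc zero) e
          (cancelʳ (left (outer (suc zero)) j) (left (suc zero) k) (right (suc zero) k) (differs-at (suc zero) k f))
        at-innermost e (suc (suc s)) f = first false e (subst (λ c → T (inside c xor false)) (≡.sym f) tt)

        at-outermost : ∀ b → A i ≡ b → Differing (i , j , k)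
        at-outermost true  e = at-middle e (class j) refl
        at-outermost false e = at-innermost e (class k) refl

    merged : Taylor (Fin (3 + n))
    merged = record
      { term = cube ; left = left′ ; right = right′ ; balanced = balanced′
      ; class = λ p → proj₁ (differing p) ; differs = λ p → proj₂ (differing p) }

  merge-all : ∀ n → Taylor (Fin (3 + n)) → Taylor (Fin 3)
  merge-all zero    τ = τ
  merge-all (suc n) τ = merge-all n (Merge.merged τ)

  -- Surjectivity of `e` supplies an equation for every class; repeated equations do no harm.
  reindex : ∀ {K L : Set} (e : L → K) → (∀ k → Σ[ l ∈ L ] e l ≡ k) → Taylor K → Taylor L
  reindex e onto τ = record
    { term     = term
    ; left     = left ∘ e
    ; right    = right ∘ e
    ; balanced = balanced ∘ e
    ; class    = λ i → proj₁ (onto (class i))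
    ; differs  = λ i → subst (λ k → T (left k i xor right k i)) (≡.sym (proj₂ (onto (class i)))) (differs i)
    }
    where open Taylor τ

-- Compactness

module Classically (classical : Classical) where
  open Classical classical

  -- By excluded middle every predicate, of any level, defines a subset.
  module Subsets {ℓ} (X : Set ℓ) where

    Subset : Set ℓ
    Subset = X → Bool

    ⟦_⟧ : ∀ {a} → Set a → Bool
    ⟦ P ⟧ = does (excludedMiddle {P = P})

    ⟦⟧-intro : ∀ {a} {P : Set a} → P → ⟦ P ⟧ ≡ true
    ⟦⟧-intro {P = P} p with excludedMiddle {P = P}
    ... | yes _ = refl
    ... | no ¬p = ⊥-elim (¬p p)

    ⟦⟧-elim : ∀ {a} {P : Set a} → ⟦ P ⟧ ≡ true → P
    ⟦⟧-elim {P = P} e with excludedMiddle {P = P}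
    ... | yes p = p

    infix 4 _⊆_
    _⊆_ : Subset → Subset → Set ℓ
    S ⊆ S′ = ∀ x → S x ≡ true → S′ x ≡ true

    ⊆-antisym : ∀ {S S′} → S ⊆ S′ → S′ ⊆ S → S ≡ S′
    ⊆-antisym {S} {S′} p q = extensionality λ x → same x (S x) (S′ x) refl refl
      where
      same : ∀ x a b → S x ≡ a → S′ x ≡ b → S x ≡ S′ x
      same x true  _     e f = ≡.trans e (≡.sym (p x e))
      same x false true  e f = ≡.trans (q x f) (≡.sym f)
      same x false false e f = ≡.trans e (≡.sym f)

    ⋃ : (Subset → Bool) → Subset
    ⋃ 𝓕 x = ⟦ (Σ[ S ∈ Subset ] 𝓕 S ≡ true × S x ≡ true) ⟧

    ⋃-upper : ∀ 𝓕 {S} → 𝓕 S ≡ true → S ⊆ ⋃ 𝓕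
    ⋃-upper 𝓕 f x e = ⟦⟧-intro (_ , f , e)

    -- A fixed point of an inflationary map

    module Tower (next : Subset → Subset) (inflationary : ∀ S → S ⊆ next S) where

      -- Zermelo's substitute for transfinite iteration. Families are Boolean valued, so that the
      -- tower stays in level `ℓ`.
      data Tower : Subset → Set ℓ where
        step  : ∀ {S} → Tower S → Tower (next S)
        union : ∀ 𝓕 → (∀ S → 𝓕 S ≡ true → Tower S) → Tower (⋃ 𝓕)

      private
        ⋃-bounded-or-not : ∀ 𝓕 S → (⋃ 𝓕 ⊆ S) ⊎ (Σ[ S′ ∈ Subset ] 𝓕 S′ ≡ true × ¬ S′ ⊆ S)
        ⋃-bounded-or-not 𝓕 S with excludedMiddle {P = Σ[ S′ ∈ Subset ] 𝓕 S′ ≡ true × ¬ S′ ⊆ S}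
        ... | yes p = inj₂ p
        ... | no ¬p = inj₁ λ x e → bounded x (⟦⟧-elim e)
          where
          bounded : ∀ x → (Σ[ S′ ∈ Subset ] 𝓕 S′ ≡ true × S′ x ≡ true) → S x ≡ true
          bounded x (S′ , f , e) with excludedMiddle {P = S′ ⊆ S}
          ... | yes q = q x e
          ... | no ¬q = ⊥-elim (¬p (S′ , f , ¬q))

        -- Nothing in the tower lies strictly between `S` and `next S`. A union not contained in `S`
        -- has a member not contained in `S`, and this member already contains `next S`.
        successor : ∀ {S} → (∀ {S′} → Tower S′ → S ⊆ S′ ⊎ next S′ ⊆ S) →
                    ∀ {S′} → Tower S′ → S ⊆ S′ → S ≡ S′ ⊎ next S ⊆ S′
        successor {S} compare (step {S′} t) p with compare t
        ... | inj₂ q = inj₁ (⊆-antisym p q)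
        ... | inj₁ q with successor compare t q
        ...   | inj₁ refl = inj₂ λ x e → e
        ...   | inj₂ r    = inj₂ λ x e → inflationary S′ x (r x e)
        successor {S} compare (union 𝓕 h) p with ⋃-bounded-or-not 𝓕 S
        ... | inj₁ q = inj₁ (⊆-antisym p q)
        ... | inj₂ (S′ , f , ¬q) with compare (h S′ f)
        ...   | inj₂ r = ⊥-elim (¬q λ x e → r x (inflationary S′ x e))
        ...   | inj₁ r with successor compare (h S′ f) r
        ...     | inj₁ refl = ⊥-elim (¬q λ x e → e)
        ...     | inj₂ q    = inj₂ λ x e → ⋃-upper 𝓕 f x (q x e)

      -- The second alternative has `next S′` instead of `S′` because `successor` turns it into an
      -- equality in its `step` case.
      compare : ∀ {S} → Tower S → ∀ {S′} → Tower S′ → S ⊆ S′ ⊎ next S′ ⊆ S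
      compare (step {S} t) {S′} t′ with compare t t′
      ... | inj₂ p = inj₂ λ x e → inflationary S x (p x e)
      ... | inj₁ p with successor (compare t) t′ p
      ...   | inj₁ refl = inj₂ λ x e → e
      ...   | inj₂ q    = inj₁ q
      compare (union 𝓕 h) {S′} t′ with ⋃-bounded-or-not 𝓕 S′
      ... | inj₁ p = inj₁ p
      ... | inj₂ (S , f , ¬p) with compare (h S f) t′
      ...   | inj₁ q = ⊥-elim (¬p q)
      ...   | inj₂ q = inj₂ λ x e → ⋃-upper 𝓕 f x (q x e)

      comparable : ∀ {S S′} → Tower S → Tower S′ → S ⊆ S′ ⊎ S′ ⊆ S
      comparable {S′ = S′} t t′ with compare t t′
      ... | inj₁ p = inj₁ p
      ... | inj₂ p = inj₂ λ x e → p x (inflationary S′ x e)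

      top : Subset
      top = ⋃ λ S → ⟦ Tower S ⟧

      top-in-tower : Tower top
      top-in-tower = union _ λ S → ⟦⟧-elim

      top-fixed : next top ⊆ top
      top-fixed = ⋃-upper _ (⟦⟧-intro (step top-in-tower))

  -- The proof maximises the set of excluded values.
  module Compactness {ℓ} (Key Condition : Set ℓ) (size : Key → ℕ)
    (_⊩_ : (∀ k → Fin (size k)) → Condition → Set)
    (support : Condition → List Key)
    (local : ∀ {γ γ′} c → (∀ {k} → k ∈ support c → γ k ≡ γ′ k) → γ ⊩ c → γ′ ⊩ c) where

    Choice : Set ℓ
    Choice = ∀ k → Fin (size k)

    Value : Set ℓ
    Value = Σ[ k ∈ Key ] Fin (size k)

    open Subsets Value

    Avoids : Choice → Subset → Value → Set
    Avoids γ S (k , i) = S (k , i) ≡ true → γ k ≢ i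

    -- Only finitely many exclusions and conditions are imposed at once; this is what survives
    -- unions of chains.
    Consistent : Subset → Set ℓ
    Consistent S = ∀ vs cs → Σ[ γ ∈ Choice ] All (Avoids γ S) vs × All (γ ⊩_) cs

    insert : Value → Subset → Subset
    insert v S w = ⟦ (S w ≡ true ⊎ v ≡ w) ⟧

    Extension : Subset → Set ℓ
    Extension S = Σ[ v ∈ Value ] S v ≢ true × Consistent (insert v S)

    -- The decision is an argument so that proofs about `next` can split on it.
    extend : ∀ {S} → Dec (Extension S) → Subset
    extend {S} (yes (v , _)) = insert v S
    extend {S} (no _)        = S

    next : Subset → Subset
    next S = extend {S} excludedMiddle

    inflationary : ∀ S → S ⊆ next S
    inflationary S x e = go excludedMiddle
      where
      go : (d : Dec (Extension S)) → extend d x ≡ true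
      go (yes _) = ⟦⟧-intro (inj₁ e)
      go (no _)  = e

    open Tower next inflationary

    module _ (∅-consistent : ∀ cs → Σ[ γ ∈ Choice ] All (γ ⊩_) cs) where

      private
        ∅ : Subset
        ∅ = ⋃ λ _ → false

        ∅-empty : ∀ v → ∅ v ≢ true
        ∅-empty v e with ⟦⟧-elim e
        ... | _ , () , _

      -- For a union: the tower is a chain, so those of the finitely many values `vs` that the union
      -- excludes are all excluded by a single member.
      consistent : ∀ {S} → Tower S → Consistent S
      consistent (step {S} t) = go excludedMiddle
        where
        go : (d : Dec (Extension S)) → Consistent (extend d)
        go (yes (_ , _ , c)) = c
        go (no _)            = consistent t
      consistent (union 𝓕 h) vs cs =
        let S , _ , S-consistent , p = member vs
            γ , a , s                = S-consistent vs cs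
        in γ , All.zipWith (λ { {k , i} (q , b) e → b (q e) }) (p , a) , s
        where
        member : ∀ vs → Σ[ S ∈ Subset ] Tower S × Consistent S × All (λ v → ⋃ 𝓕 v ≡ true → S v ≡ true) vs
        member [] = ∅ , union _ (λ _ ()) ,
          (λ ws cs → proj₁ (∅-consistent cs) , All.tabulate (λ {w} _ e → ⊥-elim (∅-empty w e)) ,
                     proj₂ (∅-consistent cs)) , []
        member (v ∷ vs) with member vs | excludedMiddle {P = ⋃ 𝓕 v ≡ true}
        ... | S , t , c , p | no ¬e = S , t , c , (λ e → ⊥-elim (¬e e)) ∷ p
        ... | S , t , c , p | yes e with ⟦⟧-elim e
        ...   | S′ , f , e′ with comparable t (h S′ f)
        ...     | inj₁ q = S′ , h S′ f , consistent (h S′ f) , (λ _ → e′) ∷ All.map (λ {w} r u → q w (r u)) p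
        ...     | inj₂ q = S , t , c , (λ _ → q v e′) ∷ p

      private
        values : Key → List Value
        values k = map (k ,_) (allFin (size k))

        top-maximal : ∀ v → top v ≢ true → ¬ Consistent (insert v top)
        top-maximal v n c = go excludedMiddle top-fixed
          where
          go : (d : Dec (Extension top)) → extend d ⊆ top → ⊥
          go (yes (w , m , _)) sub = m (sub w (⟦⟧-intro (inj₂ refl)))
          go (no ¬e)           _   = ¬e (v , n , c)

        Admitted : Value → Set
        Admitted v = top v ≢ true

        ¬¬ : ∀ {a} {P : Set a} → ¬ ¬ P → P
        ¬¬ {P = P} nn with excludedMiddle {P = P}
        ... | yes p = p
        ... | no ¬p = ⊥-elim (nn ¬p)

        Blocks : Value → List Value → List Condition → Set ℓ
        Blocks v vs cs = ∀ γ → All (Avoids γ (insert v top)) vs → ¬ All (γ ⊩_) cs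

        blocked : ∀ v → top v ≢ true → Σ[ vs ∈ List Value ] Σ[ cs ∈ List Condition ] Blocks v vs cs
        blocked v n = ¬¬ λ none → top-maximal v n λ vs cs →
          ¬¬ λ no-choice → none (vs , cs , λ γ a s → no-choice (γ , a , s))

        -- By maximality, excluding either value is refuted by finitely many requirements. A choice
        -- `γ` that meets both finite lists avoids `i` or, if it takes `i`, avoids `j`, and
        -- contradicts one refutation.
        unique : ∀ k i j → Admitted (k , i) → Admitted (k , j) → i ≡ j
        unique k i j p q with excludedMiddle {P = i ≡ j}
        ... | yes e = e
        ... | no i≢j with blocked (k , i) p | blocked (k , j) q
        ... | vs , cs , b | vs′ , cs′ , b′ with consistent top-in-tower (vs ++ vs′) (cs ++ cs′)
        ... | γ , a , s with excludedMiddle {P = γ k ≡ i}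
        ...   | no γk≢i = ⊥-elim (b γ (All.map (avoid γk≢i) (++⁻ˡ vs a)) (++⁻ˡ cs s))
          where
          avoid : ∀ {i w} → γ k ≢ i → Avoids γ top w → Avoids γ (insert (k , i) top) w
          avoid n h e with ⟦⟧-elim e
          ... | inj₁ e′   = h e′
          ... | inj₂ refl = n
        ...   | yes refl = ⊥-elim (b′ γ (All.map (avoid i≢j) (++⁻ʳ vs a)) (++⁻ʳ cs s))
          where
          avoid : ∀ {i w} → γ k ≢ i → Avoids γ top w → Avoids γ (insert (k , i) top) w
          avoid n h e with ⟦⟧-elim e
          ... | inj₁ e′   = h e′
          ... | inj₂ refl = n

        admitted : ∀ {γ vs k} → All (Avoids γ top) vs → (k , γ k) ∈ vs → Admitted (k , γ k)
        admitted a m e = All.lookup a m e refl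

        inhabited : ∀ k → Σ[ i ∈ Fin (size k) ] Admitted (k , i)
        inhabited k with consistent top-in-tower (values k) []
        ... | γ , a , _ = γ k , admitted a (∈-map⁺ (k ,_) (∈-allFin (γ k)))

      limit : Choice
      limit k = proj₁ (inhabited k)

      limit-satisfies : ∀ c → limit ⊩ c
      limit-satisfies c with consistent top-in-tower (concatMap values (support c)) (c ∷ [])
      ... | γ , a , (s ∷ []) = local c agree s
        where
        agree : ∀ {k} → k ∈ support c → γ k ≡ limit k
        agree {k} m = unique k _ _
          (admitted a (∈-concatMap⁺ values (Any.map (λ { refl → ∈-map⁺ (k ,_) (∈-allFin (γ k)) }) m)))
          (proj₂ (inhabited k))

-- Terms and projections

module Finite {ℓ} {Δ : Signature ℓ} where

  private
    variable
      X : Set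

  -- The first argument is the depth at which the symbol occurs.
  Strategy : Set ℓ
  Strategy = ℕ → (f : Op Δ) → Fin (arity Δ f)

  project : Strategy → Term Δ X → X
  project γ (var a)    = a
  project γ (app f ts) = project (γ ∘ suc) (ts (γ 0 f))

  data Within (fs : List (Op Δ)) {X : Set} : ℕ → Term Δ X → Set ℓ where
    var : ∀ {n a} → Within fs n (var a)
    app : ∀ {n f ts} → f ∈ fs → (∀ i → Within fs n (ts i)) → Within fs (suc n) (app f ts)

  within-mono : ∀ {fs fs′ m n} {t : Term Δ X} → fs ⊑ fs′ → m ≤ n → Within fs m t → Within fs′ n t
  within-mono p q var                   = var
  within-mono p (s≤s q) (app f∈fs h) = app (p f∈fs) (λ i → within-mono p q (h i))

  Bounded : {I : Set} → (I → Term Δ X) → Set ℓ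
  Bounded ts = Σ[ fs ∈ List (Op Δ) ] Σ[ n ∈ ℕ ] (∀ i → Within fs n (ts i))

  bounded : ∀ {n} (ts : Fin n → Term Δ X) → (∀ i → Σ[ fs ∈ List (Op Δ) ] Σ[ n ∈ ℕ ] Within fs n (ts i)) → Bounded ts
  bounded {n = zero}  ts h = [] , 0 , λ ()
  bounded {n = suc _} ts h with h zero | bounded (ts ∘ suc) (h ∘ suc)
  ... | fs , m , w | fs′ , m′ , w′ = fs ++ fs′ , m ⊔ m′ , λ where
    zero    → within-mono (∈-++⁺ˡ {xs = fs}) (m≤m⊔n m m′) w
    (suc i) → within-mono (∈-++⁺ʳ fs) (m≤n⊔m m m′) (w′ i)

  within : (t : Term Δ X) → Σ[ fs ∈ List (Op Δ) ] Σ[ n ∈ ℕ ] Within fs n t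
  within (var a)    = [] , 0 , var
  within (app f ts) with bounded ts (λ i → within (ts i))
  ... | fs , n , w = f ∷ fs , suc n , app (here refl) (λ i → within-mono there ≤-refl (w i))

  project-local : ∀ {γ γ′ : Strategy} {fs n} {t : Term Δ X} → Within fs n t →
                  (∀ {l f} → l < n → f ∈ fs → γ l f ≡ γ′ l f) → project γ t ≡ project γ′ t
  project-local var e = refl
  project-local {γ′ = γ′} (app {f = f} {ts} f∈fs w) e rewrite e (s≤s z≤n) f∈fs =
    project-local (w (γ′ 0 f)) (λ l<n → e (s≤s l<n))

  Enumerated : Set → Set
  Enumerated A = Σ[ n ∈ ℕ ] Σ[ e ∈ (Fin n → A) ] (∀ a → Σ[ i ∈ Fin n ] e i ≡ a)

  enumerate-× : ∀ {A C : Set} → Enumerated A → Enumerated C → Enumerated (A × C)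
  enumerate-× (m , e , onto) (n , e′ , onto′) = m * n ,
    (λ k → let i , j = remQuot {m} n k in e i , e′ j) ,
    λ (a , c) → let i , p = onto a
                    j , q = onto′ c
      in combine i j , ≡.trans (cong (λ (i , j) → e i , e′ j) (remQuot-combine i j)) (cong₂ _,_ p q)

  module Trees (default : ∀ f → Fin (arity Δ f)) (_≟ₒ_ : (f g : Op Δ) → Dec (f ≡ g)) where

    Choices : List (Op Δ) → Set
    Choices []       = ⊤
    Choices (f ∷ fs) = Fin (arity Δ f) × Choices fs

    -- The first occurrence of a symbol in the list decides; symbols outside the list get the
    -- default.
    select : ∀ fs → Choices fs → ∀ f → Fin (arity Δ f)
    select []       _       f = default f
    select (g ∷ fs) (i , c) f with g ≟ₒ f
    ... | yes refl = i
    ... | no _     = select fs c f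

    branching : ∀ fs → Term Δ (Choices fs)
    branching []       = var tt
    branching (f ∷ fs) = app f (λ i → branching fs [ (λ c → var (i , c)) ])

    module _ (fs : List (Op Δ)) where
      Path : ℕ → Set
      Path = Vec (Choices fs)

      strategy : ∀ {n} → Path n → Strategy
      strategy []      _       = default
      strategy (c ∷ p) zero    = select fs c
      strategy (c ∷ p) (suc l) = strategy p l

      -- A place of this term is a strategy for the symbols in `fs` down to depth `n`.
      tree : ∀ n → Term Δ (Path n)
      tree zero    = var []
      tree (suc n) = branching fs [ (λ c → tree n [ (λ p → var (c ∷ p)) ]) ]

    module Values (B : Algebra Δ)
      (idempotent : ∀ f a → Algebra._≈_ B (Algebra.op B f (λ _ → a)) a) where
      open Algebra B
      open Setoid setoid using () renaming (refl to ≈-refl; sym to ≈-sym; trans to ≈-trans)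
      open Evaluation B
      open Idempotent B idempotent
      open SetoidReasoning setoid

      eval-branching : ∀ {fs f} → f ∈ fs → (v : Fin (arity Δ f) → Carrier) →
                       eval B (λ c → v (select fs c f)) (branching fs) ≈ op f v
      eval-branching {g ∷ fs} {f} m v with g ≟ₒ f
      ... | yes refl = op-cong f λ i → ≈-trans (eval-[] _ _ (branching fs)) (eval-const _ (branching fs))
      eval-branching {g ∷ fs} {f} (here refl) v | no g≢f = ⊥-elim (g≢f refl)
      eval-branching {g ∷ fs} {f} (there m)   v | no g≢f =
        ≈-trans (op-cong g λ i → ≈-trans (eval-[] _ _ (branching fs)) (eval-branching m v)) (idempotent g _)

      -- Each level of the tree contains the symbol that `t` has at that depth; the other symbols of
      -- the level, and all levels below a variable, collapse by idempotence.
      eval-tree : ∀ {fs n} {t : Term Δ X} → Within fs n t → (ρ : X → Carrier) →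
                  eval B (λ p → ρ (project (strategy fs p) t)) (tree fs n) ≈ eval B ρ t
      eval-tree {fs = fs} {n} var ρ = eval-const _ (tree fs n)
      eval-tree {fs = fs} {suc n} (app {f = f} {ts} m w) ρ = begin
        eval B (λ p → ρ (project (strategy fs p) (app f ts))) (tree fs (suc n))
          ≈⟨ ≈-trans (eval-[] _ _ (branching fs)) (eval-cong (λ c → eval-[] _ _ (tree fs n)) (branching fs)) ⟩
        eval B (λ c → eval B (λ p → ρ (project (strategy fs p) (ts (select fs c f)))) (tree fs n)) (branching fs)
          ≈⟨ eval-cong (λ c → eval-tree (w (select fs c f)) ρ) (branching fs) ⟩
        eval B (λ c → eval B ρ (ts (select fs c f))) (branching fs)
          ≈⟨ eval-branching m (λ i → eval B ρ (ts i)) ⟩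
        op f (λ i → eval B ρ (ts i)) ∎

    enumerate-choices : ∀ fs → Enumerated (Choices fs)
    enumerate-choices []       = 1 , (λ _ → tt) , λ _ → zero , refl
    enumerate-choices (f ∷ fs) = enumerate-× (_ , (λ i → i) , λ i → i , refl) (enumerate-choices fs)

    enumerate-paths : ∀ fs n → Enumerated (Path fs n)
    enumerate-paths fs zero    = 1 , (λ _ → []) , λ { [] → zero , refl }
    enumerate-paths fs (suc n) with enumerate-× (enumerate-choices fs) (enumerate-paths fs n)
    ... | m , e , onto = m , (λ i → let c , p = e i in c ∷ p) ,
      λ { (c ∷ p) → let i , q = onto (c , p) in i , cong (λ (c , p) → c ∷ p) q }

    some-path : ∀ fs n → Path fs n
    some-path fs zero    = []
    some-path fs (suc n) = some-choices fs ∷ some-path fs n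
      where
      some-choices : ∀ fs → Choices fs
      some-choices []       = tt
      some-choices (f ∷ fs) = default f , some-choices fs

-- A Taylor term or an assignment of projections

module Dichotomy (classical : Classical) {ℓ} {Δ : Signature ℓ} (default : ∀ f → Fin (arity Δ f))
  (B : Algebra Δ) (idempotent : ∀ f a → Algebra._≈_ B (Algebra.op B f (λ _ → a)) a) where
  open Algebra B
  open Setoid setoid using () renaming (refl to ≈-refl; sym to ≈-sym; trans to ≈-trans)
  open Classical classical
  open Finite {Δ = Δ}
  open Trees default (λ f g → excludedMiddle)
  open Values B idempotent
  open Evaluation B
  open Idempotent B idempotent
  open Reduction B idempotent using (reindex; merge-all; taylor₂)

  Identity : Set ℓ
  Identity = Σ[ s ∈ Term Δ ℕ ] Σ[ t ∈ Term Δ ℕ ] (∀ ρ → eval B ρ s ≈ eval B ρ t)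

  sides : Identity → Fin 2 → Term Δ ℕ
  sides (s , t , _) zero    = s
  sides (s , t , _) (suc _) = t

  bounded-identity : ∀ c → Bounded (sides c)
  bounded-identity c = bounded (sides c) (λ i → within (sides c i))

  Respects : Strategy → Identity → Set
  Respects γ (s , t , _) = project γ s ≡ project γ t

  bounded-identities : ∀ cs → Σ[ fs ∈ List (Op Δ) ] Σ[ n ∈ ℕ ] (∀ {c} → c ∈ cs → ∀ i → Within fs n (sides c i))
  bounded-identities []       = [] , 0 , λ ()
  bounded-identities (c ∷ cs) with bounded-identity c | bounded-identities cs
  ... | fs , m , w | fs′ , m′ , w′ = fs ++ fs′ , m ⊔ m′ , λ where
    (here refl) i → within-mono (∈-++⁺ˡ {xs = fs}) (m≤m⊔n m m′) (w i)
    (there c∈)  i → within-mono (∈-++⁺ʳ fs) (m≤n⊔m m m′) (w′ c∈ i)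

  support : Identity → List (ℕ × Op Δ)
  support c = let fs , n , _ = bounded-identity c in cartesianProduct (upTo n) fs

  local : ∀ {γ γ′ : ∀ k → Fin (arity Δ (proj₂ k))} c → (∀ {k} → k ∈ support c → γ k ≡ γ′ k) →
          Respects (λ l f → γ (l , f)) c → Respects (λ l f → γ′ (l , f)) c
  local {γ} {γ′} c agree r = ≡.trans (≡.sym (unchanged zero)) (≡.trans r (unchanged (suc zero)))
    where
    unchanged : ∀ i → project (λ l f → γ (l , f)) (sides c i) ≡ project (λ l f → γ′ (l , f)) (sides c i)
    unchanged i = let fs , n , w = bounded-identity c in
      project-local (w i) (λ {l} {f} l<n f∈fs →
        agree (∈-cartesianProduct⁺ {xs = upTo n} {ys = fs} (∈-upTo⁺ l<n) f∈fs))

  -- There is one equation for each place `p` of the tree, read off from an identity that the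
  -- strategy of `p` breaks.
  taylor-from : ∀ cs → (∀ γ → ¬ All (Respects γ) cs) → Taylor (Fin 2)
  taylor-from cs none = taylor₂ (merge-all size (reindex e onto record
    { term     = tree fs n
    -- The variable that `p` selects on the left becomes `true`, every other one `false`; at place
    -- `p` the sides thus receive `true` and `false`.
    ; left     = λ p q → does (project (strategy fs q) (proj₁ (broken p)) ≟ variable-of p)
    ; right    = λ p q → does (project (strategy fs q) (proj₁ (proj₂ (broken p))) ≟ variable-of p)
    ; balanced = λ p ρ → let ρ′ = λ m → ρ (does (m ≟ variable-of p)) in
        ≈-trans (eval-tree (w (broken∈ p) zero) ρ′)
          (≈-trans (proj₂ (proj₂ (broken p)) ρ′) (≈-sym (eval-tree (w (broken∈ p) (suc zero)) ρ′)))
    ; class    = λ p → p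
    ; differs  = λ p → distinguished (breaks p) (_ ≟ _) (_ ≟ _)
    }))
    where
    fs = proj₁ (bounded-identities cs)
    n  = proj₁ (proj₂ (bounded-identities cs))

    w : ∀ {c} → c ∈ cs → ∀ i → Within fs n (sides c i)
    w = proj₂ (proj₂ (bounded-identities cs))

    failure : ∀ p → Σ[ c ∈ Identity ] c ∈ cs × ¬ Respects (strategy fs p) c
    failure p = find (¬All⇒Any¬ (λ _ → _ ≟ _) cs (none (strategy fs p)))

    broken : Path fs n → Identity
    broken p = proj₁ (failure p)

    broken∈ : ∀ p → broken p ∈ cs
    broken∈ p = proj₁ (proj₂ (failure p))

    breaks : ∀ p → ¬ Respects (strategy fs p) (broken p)
    breaks p = proj₂ (proj₂ (failure p))

    variable-of : Path fs n → ℕ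
    variable-of p = project (strategy fs p) (proj₁ (broken p))

    distinguished : ∀ {a b : ℕ} → a ≢ b → (d : Dec (a ≡ a)) (d′ : Dec (b ≡ a)) → T (does d xor does d′)
    distinguished a≢b (no a≢a) _         = ⊥-elim (a≢a refl)
    distinguished a≢b (yes _)  (yes b≡a) = ⊥-elim (a≢b (≡.sym b≡a))
    distinguished a≢b (yes _)  (no _)    = tt

    size = proj₁ (enumerate-paths fs n)

    -- Three additional copies of a path guarantee the three equations at which `merge-all` stops.
    e : Fin (3 + size) → Path fs n
    e (suc (suc (suc i))) = proj₁ (proj₂ (enumerate-paths fs n)) i
    e _                   = some-path fs n

    onto : ∀ p → Σ[ i ∈ Fin (3 + size) ] e i ≡ p
    onto p = let i , q = proj₂ (proj₂ (enumerate-paths fs n)) p in suc (suc (suc i)) , q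

  -- The identities between f(x₀, x₁, …) and f(… f(f(x₀, x₁, …), …) …) force a strategy that
  -- respects all identities of B to be independent of the depth.
  pad : ∀ f → ℕ → Term Δ ℕ
  pad f zero    = app f (λ i → var (toℕ i))
  pad f (suc l) = app f (λ _ → pad f l)

  eval-pad : ∀ f l ρ → eval B ρ (pad f zero) ≈ eval B ρ (pad f l)
  eval-pad f zero    ρ = ≈-refl
  eval-pad f (suc l) ρ = ≈-trans (eval-pad f l ρ) (≈-sym (idempotent f _))

  project-pad : ∀ γ f l → project γ (pad f l) ≡ toℕ (γ l f)
  project-pad γ f zero    = refl
  project-pad γ f (suc l) = project-pad (γ ∘ suc) f l

  Projective : Set ℓ
  Projective = Σ[ π ∈ (∀ f → Fin (arity Δ f)) ]
    (∀ (s t : Term Δ ℕ) → (∀ ρ → eval B ρ s ≈ eval B ρ t) → project (λ _ → π) s ≡ project (λ _ → π) t)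

  projective-from : Σ[ γ ∈ Strategy ] (∀ c → Respects γ c) → Projective
  projective-from (γ , r) = γ 0 , λ s t h →
    ≡.trans (≡.sym (uniform s)) (≡.trans (r (s , t , h)) (uniform t))
    where
    constant : ∀ l f → γ l f ≡ γ 0 f
    constant l f = toℕ-injective (≡.trans (≡.sym (project-pad γ f l))
      (≡.sym (r (pad f 0 , pad f l , eval-pad f l))))

    uniform : ∀ (t : Term Δ ℕ) → project γ t ≡ project (λ _ → γ 0) t
    uniform t = let fs , n , w = within t in project-local w (λ {l} {f} _ _ → constant l f)

  -- If no finite list of identities excludes every strategy, compactness applies, with pairs of a
  -- depth and a symbol as keys and argument places as values.
  taylor-or-projective : Taylor (Fin 2) ⊎ Projective
  taylor-or-projective
    with excludedMiddle {P = Σ[ cs ∈ List Identity ] (∀ γ → ¬ All (Respects γ) cs)}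
  ... | yes (cs , none) = inj₁ (taylor-from cs none)
  ... | no ¬none        = inj₂ (projective-from
    ((λ l f → limit finitely (l , f)) , limit-satisfies finitely))
    where
    open Classically classical
    open Compactness (ℕ × Op Δ) Identity (λ (_ , f) → arity Δ f) (λ γ → Respects (λ l f → γ (l , f))) support local

    finitely : ∀ cs → Σ[ γ ∈ Choice ] All (λ c → Respects (λ l f → γ (l , f)) c) cs
    finitely cs with excludedMiddle {P = Σ[ γ ∈ Choice ] All (λ c → Respects (λ l f → γ (l , f)) c) cs}
    ... | yes p = p
    ... | no ¬p = ⊥-elim (¬none (cs , λ γ a → ¬p ((λ (l , f) → γ l f) , a)))

-- The equivalence

module _ {ℓ} {S Δ : Signature ℓ} (A : Algebra S) (τ : Interpretation Δ S) where
  open Algebra A using (op-cong; setoid)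
  open Setoid setoid using (_≈_) renaming (sym to ≈-sym; trans to ≈-trans; refl to ≈-refl)

  reduct : Algebra Δ
  reduct = record
    { setoid  = setoid
    ; op      = λ f as → eval A as (τ f)
    ; op-cong = λ f e → Evaluation.eval-cong A e (τ f)
    }

  eval-reduct : ∀ {X : Set} ρ (t : Term Δ X) → eval reduct ρ t ≈ eval A ρ (translate τ t)
  eval-reduct ρ (var a)    = ≈-refl
  eval-reduct ρ (app f ts) = ≈-trans (Evaluation.eval-cong A (λ i → eval-reduct ρ (ts i)) (τ f))
    (≈-sym (Evaluation.eval-[] A ρ (λ i → translate τ (ts i)) (τ f)))

module _ {ℓ} (𝒮 : EquationalCondition ℓ) where
  open EquationalCondition 𝒮 renaming (signature to Δ)
  open Equation

  projective⇒trivial : (π : ∀ f → Fin (arity Δ f)) →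
    (∀ i → Finite.project (λ _ → π) (lhs (equation i)) ≡
           Finite.project (λ _ → π) (rhs (equation i))) →
    Trivial 𝒮
  projective⇒trivial π respects {S} C = τ , λ i ρ → C.reflexive
      (≡.trans (eval-projection ρ (lhs (equation i)))
        (≡.trans (cong ρ (respects i)) (≡.sym (eval-projection ρ (rhs (equation i))))))
    where
    module C = Setoid (Algebra.setoid C)

    τ : Interpretation Δ S
    τ f = var (π f)

    eval-projection : ∀ ρ t → eval C ρ (translate τ t) ≡ ρ (Finite.project (λ _ → π) t)
    eval-projection ρ (var a)    = refl
    eval-projection ρ (app f ts) = eval-projection ρ (ts (π f))

row₁ row₂ row₃ : ∀ {a} {A : Set a} → A → A → Vector A 6
row₁ a b = a ◂ b ◂ b ◂ b ◂ a ◂ a ◂ ◇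
row₂ a b = b ◂ a ◂ b ◂ a ◂ b ◂ a ◂ ◇
row₃ a b = b ◂ b ◂ a ◂ a ◂ a ◂ b ◂ ◇

everywhere₆ : ∀ {p} {P : Fin 6 → Set p} → P 0F → P 1F → P 2F → P 3F → P 4F → P 5F → ∀ i → P i
everywhere₆ p _ _ _ _ _ 0F = p
everywhere₆ _ p _ _ _ _ 1F = p
everywhere₆ _ _ p _ _ _ 2F = p
everywhere₆ _ _ _ p _ _ 3F = p
everywhere₆ _ _ _ _ p _ 4F = p
everywhere₆ _ _ _ _ _ p 5F = p

module _ {ℓ} {S : Signature ℓ} (A : Algebra S) where
  open Algebra A using (setoid; Carrier)
  open Setoid setoid using (_≈_) renaming (sym to ≈-sym; trans to ≈-trans; refl to ≈-refl)
  open Evaluation A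

  module _ (𝒮 : EquationalCondition ℓ) (idempotent-condition : IdempotentCondition 𝒮)
    (satisfied : SatisfiedIn 𝒮 A) where
    open EquationalCondition 𝒮 renaming (signature to Δ)
    open Equation

    private
      τ : Interpretation Δ S
      τ = proj₁ satisfied

      B : Algebra Δ
      B = reduct A τ

    reduct-satisfies : ∀ i → B ⊨ equation i
    reduct-satisfies i ρ = ≈-trans (eval-reduct A τ ρ (lhs (equation i)))
      (≈-trans (proj₂ satisfied i ρ) (≈-sym (eval-reduct A τ ρ (rhs (equation i)))))

    reduct-idempotent : ∀ f a → Algebra.op B f (λ _ → a) ≈ a
    reduct-idempotent f a = idempotent-condition f B reduct-satisfies (λ _ → a)

    -- An idempotent constant equals every element, so any two elements are equal and a variable
    -- serves as the term.
    nullary⇒olšák : ∀ f → arity Δ f ≡ 0 → HasOlšákTerm A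
    nullary⇒olšák f arity≡0 = var 0F , (λ ρ → equal _ _) , (λ ρ → equal _ _) , (λ ρ → equal _ _)
      where
      empty : ∀ {n} → n ≡ 0 → ¬ Fin n
      empty refl ()

      equal : ∀ a b → a ≈ b
      equal a b = ≈-trans (≈-sym (reduct-idempotent f a))
        (≈-trans (Algebra.op-cong B f (λ i → ⊥-elim (empty arity≡0 i))) (reduct-idempotent f b))

    open Idempotent B reduct-idempotent

    loop⇒olšák : Σ[ w ∈ F ] NAE₃ w w w → HasOlšákTerm A
    loop⇒olšák (w , loop) = translate τ t , idempotent ,
        (λ ρ → ≈-trans (row 0F _ (λ a b c ok → proj₁ (rows-at a b c ok)) ρ)
                 (≈-sym (row 1F _ (λ a b c ok → proj₁ (proj₂ (rows-at a b c ok))) ρ))) ,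
        (λ ρ → ≈-trans (row 1F _ (λ a b c ok → proj₁ (proj₂ (rows-at a b c ok))) ρ)
                 (≈-sym (row 2F _ (λ a b c ok → proj₂ (proj₂ (rows-at a b c ok))) ρ)))
      where
      -- The six nonconstant triples, with `true` for `x`, are the columns of Olšák's three rows;
      -- the last clause is meant for `true true false`.
      place : Bool → Bool → Bool → Fin 6
      place true  false false = 0F
      place false true  false = 1F
      place false false true  = 2F
      place false true  true  = 3F
      place true  false true  = 4F
      place _     _     _     = 5F

      t : Term Δ (Fin 6)
      t = Rel.term loop [ (λ (v , _) → var (place (v 0F) (v 1F) (v 2F))) ]

      eval-t : ∀ ρ (σ : Fin 6 → Term S ℕ) → eval A ρ (translate τ t [ σ ]) ≈
               eval B (λ (v , _) → eval A ρ (σ (place (v 0F) (v 1F) (v 2F)))) (Rel.term loop)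
      eval-t ρ σ = ≈-trans (eval-[] ρ σ (translate τ t))
        (≈-trans (≈-sym (eval-reduct A τ _ t)) (Evaluation.eval-[] B _ _ (Rel.term loop)))

      idempotent : IsIdempotentIn A (translate τ t)
      idempotent ρ = ≈-trans (eval-t ρ (λ _ → x)) (eval-const (ρ 0) (Rel.term loop))

      letter : Bool → Term S ℕ
      letter b = if b then x else y

      rows-at : ∀ a b c → T (nae₃ a b c) →
        row₁ x y (place a b c) ≡ letter a × row₂ x y (place a b c) ≡ letter b × row₃ x y (place a b c) ≡ letter c
      rows-at true  false false _ = refl , refl , refl
      rows-at false true  false _ = refl , refl , refl
      rows-at false false true  _ = refl , refl , refl
      rows-at false true  true  _ = refl , refl , refl
      rows-at true  false true  _ = refl , refl , refl
      rows-at true  true  false _ = refl , refl , refl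

      loop-values : ∀ k ρ → eval B (λ v → ρ (proj₁ v k)) (Rel.term loop) ≈ eval B ρ w
      loop-values 0F = Rel.values loop 0F
      loop-values 1F = Rel.values loop 1F
      loop-values 2F = Rel.values loop 2F

      row : ∀ k (σ : Fin 6 → Term S ℕ) →
        (∀ a b c → T (nae₃ a b c) → σ (place a b c) ≡ letter ((a ◂ b ◂ c ◂ ◇) k)) → ∀ ρ →
        eval A ρ (translate τ t [ σ ]) ≈ eval B (λ b → eval A ρ (letter b)) w
      row k σ σ-letter ρ = ≈-trans (eval-t ρ σ) (≈-trans
        (Evaluation.eval-cong B (λ (v , ok) → Setoid.reflexive setoid (cong (eval A ρ)
          (≡.trans (σ-letter (v 0F) (v 1F) (v 2F) ok) (cong letter (entry k v))))) (Rel.term loop))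
        (loop-values k (λ b → eval A ρ (letter b))))
        where
        entry : ∀ k (v : Fin 3 → Bool) → (v 0F ◂ v 1F ◂ v 2F ◂ ◇) k ≡ v k
        entry 0F v = refl
        entry 1F v = refl
        entry 2F v = refl

    module _ (classical : Classical) (nontrivial : Nontrivial 𝒮) where
      open Classical classical

      nontrivial⇒olšák : HasOlšákTerm A
      -- A nullary symbol admits no projection and is treated separately.
      nontrivial⇒olšák with excludedMiddle {P = Σ[ f ∈ Op Δ ] arity Δ f ≡ 0}
      ... | yes (f , arity≡0) = nullary⇒olšák f arity≡0
      ... | no ¬nullary with Dichotomy.taylor-or-projective classical default B reduct-idempotent
        where
        place : ∀ n → n ≢ 0 → Fin n
        place zero    n≢0 = ⊥-elim (n≢0 refl)
        place (suc n) n≢0 = zero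

        default : ∀ f → Fin (arity Δ f)
        default f = place (arity Δ f) (λ e → ¬nullary (f , e))
      ... | inj₁ τ₂ = loop⇒olšák (nae₃-loop τ₂)
      ... | inj₂ (π , respects) = ⊥-elim (nontrivial (projective⇒trivial 𝒮 π
        (λ i → respects (lhs (equation i)) (rhs (equation i)) (reduct-satisfies i))))

  olšák⇒nontrivial : HasOlšákTerm A → SatisfiesNontrivialIdempotentCondition A
  olšák⇒nontrivial (t , t-idempotent , e₁ , e₂) = 𝒮 , nontrivial , (λ f B h → h (lift 0F)) , (λ _ → t) , satisfied
    where
    Δ : Signature ℓ
    Δ = record { Op = Lift ℓ ⊤ ; arity = λ _ → 6 }

    t[_] : Vector ℕ 6 → Term Δ ℕ
    t[ σ ] = app (lift tt) (λ i → var (σ i))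

    equations : Fin 3 → Equation Δ
    equations 0F = t[ (λ _ → 0) ] ≋ var 0
    equations 1F = t[ row₁ 0 1 ] ≋ t[ row₂ 0 1 ]
    equations 2F = t[ row₂ 0 1 ] ≋ t[ row₃ 0 1 ]

    𝒮 : EquationalCondition ℓ
    𝒮 = record { signature = Δ ; Index = Lift ℓ (Fin 3) ; equation = λ (lift i) → equations i }

    -- Bridges two vectors of variables that agree only pointwise, not by computation.
    rename : ∀ {σ : Fin 6 → Term S ℕ} {n : Vector ℕ 6} → (∀ i → σ i ≡ var (n i)) → ∀ ρ →
             eval A ρ (t [ (λ i → var (n i)) ]) ≈ eval A ρ (t [ σ ])
    rename {σ} e ρ = ≈-trans (eval-[] ρ _ t) (≈-trans
      (eval-cong (λ i → Setoid.reflexive setoid (cong (eval A ρ) (≡.sym (e i)))) t) (≈-sym (eval-[] ρ σ t)))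

    at₁ : ∀ i → row₁ x y i ≡ var (row₁ 0 1 i)
    at₁ = everywhere₆ refl refl refl refl refl refl

    at₂ : ∀ i → row₂ x y i ≡ var (row₂ 0 1 i)
    at₂ = everywhere₆ refl refl refl refl refl refl

    at₃ : ∀ i → row₃ x y i ≡ var (row₃ 0 1 i)
    at₃ = everywhere₆ refl refl refl refl refl refl

    satisfied : ∀ i → A ⊨ translateEquation (λ _ → t) (EquationalCondition.equation 𝒮 i)
    satisfied (lift 0F) = t-idempotent
    satisfied (lift 1F) ρ = ≈-trans (rename at₁ ρ) (≈-trans (e₁ ρ) (≈-sym (rename at₂ ρ)))
    satisfied (lift 2F) ρ = ≈-trans (rename at₂ ρ) (≈-trans (e₂ ρ) (≈-sym (rename at₃ ρ)))

    empty : Signature ℓ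
    empty = record { Op = Lift ℓ ⊥ ; arity = λ () }

    two : Algebra empty
    two = record { setoid = ≡.setoid (Lift ℓ Bool) ; op = λ () ; op-cong = λ () }

    nontrivial : Nontrivial 𝒮
    nontrivial trivial =
      let τ , h = trivial two in not-a-variable (τ (lift tt)) (h (lift 1F) ρ) (h (lift 2F) ρ)
      where
      ρ : ℕ → Lift ℓ Bool
      ρ zero    = lift true
      ρ (suc _) = lift false

      value-at : Term empty (Fin 6) → Vector ℕ 6 → Lift ℓ Bool
      value-at s n = eval two ρ (s [ (λ i → var (n i)) ])

      not-a-variable : ∀ s → value-at s (row₁ 0 1) ≡ value-at s (row₂ 0 1) →
                       value-at s (row₂ 0 1) ≢ value-at s (row₃ 0 1)
      -- In every place the first two rows differ or the last two do; the absurd pattern marks the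
      -- equation that fails.
      not-a-variable (var i) = everywhere₆
        {P = λ i → ρ (row₁ 0 1 i) ≡ ρ (row₂ 0 1 i) → ρ (row₂ 0 1 i) ≢ ρ (row₃ 0 1 i)}
        (λ ()) (λ ()) (λ _ ()) (λ ()) (λ ()) (λ _ ()) i
      not-a-variable (app () _)

theorem1p1 : Classical → ∀ {ℓ} {S : Signature ℓ} (A : Algebra S) →
    SatisfiesNontrivialIdempotentCondition A ⇔ HasOlšákTerm A
theorem1p1 classical A = mk⇔
  (λ (𝒮 , nontrivial , idempotent-condition , satisfied) →
    nontrivial⇒olšák A 𝒮 idempotent-condition satisfied classical nontrivial)
  (olšák⇒nontrivial A)
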